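{- Let $(X,\mathbf{d})$ be a finite metric space with doubling dimension $\operatorname{ddim}$ and let $\epsilon\in(0,1)$. Then there exists a spanning tree $T$ of $X$ such that (a) the maximum degree of $T$ is at most $2^{O(\operatorname{ddim})}\cdot\max\{1,\log(1/\epsilon)\}$, and (b) $w(T)\le(1+\epsilon)\operatorname{MST}(X)$.
   Context: The doubling dimension of a metric space $(X,\mathbf{d})$ is the smallest $t\ge 0$ such that every metric ball $B(x,r)=\{y\in X:\mathbf{d}(x,y)\le r\}$ can be covered by at most $2^t$ balls of half the radius. A spanning tree of $X$ is a spanning tree of the complete graph on $X$; its weight $w(T)$ is the sum of $\mathbf{d}(x,y)$ over its edges $(x,y)$. $\operatorname{MST}(X)$ is the minimum weight of a spanning tree of $X$. Logarithms are base 2. The constant hidden in $O(\cdot)$ is absolute. -}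

module Defs where

open import Level using (0ℓ)
open import Algebra.Bundles using (CommutativeRing)
import Algebra.Construct.NaturalChoice.Max as Max
import Algebra.Properties.Semiring.Exp as Exp
import Algebra.Properties.Semiring.Mult as Mult
open import Data.Fin.Base as Fin using (Fin)
import Data.Fin.Properties as Fin
open import Data.List.Base
  using (List; []; _∷_; [_]; _++_; length; map; filter; foldr; allFin; cartesianProduct)
import Data.List.Extrema.Nat as Extrema
open import Data.List.Relation.Unary.Any using (Any)
open import Data.List.Relation.Unary.Linked using (Linked)
open import Data.List.Relation.Unary.Unique.Propositional using (Unique)
import Data.Nat.Base as ℕ
open ℕ using (ℕ; NonZero)
open import Data.Product.Base using (∃; _×_; _,_; uncurry)
open import Function.Metric.Structures using (IsGeneralMetric)
open import Relation.Binary.Bundles using (TotalOrder)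
open import Relation.Binary.Core using (Rel)
open import Relation.Binary.Definitions using (Decidable; Symmetric; Irreflexive)
open import Relation.Binary.Construct.Closure.ReflexiveTransitive using (Star)
import Relation.Binary.Construct.NonStrictToStrict as ToStrict
open import Relation.Binary.PropositionalEquality.Core using (_≡_)
open import Relation.Binary.Structures using (IsDecTotalOrder)
open import Relation.Nullary.Decidable using (_×-dec_)
open import Relation.Nullary.Negation using (¬_)
open import Relation.Unary using (Pred; _⊆_)

-- The real numbers, axiomatised as a complete ordered field.  The axioms
-- are the classical ones: the order is decidable, and a supremum is an
-- upper bound approximated from below by members of the set.  Being the
-- supremum in this sense is classically the same as being the least upper
-- bound; the approximation also yields excluded middle for small types, so
-- reasoning about such a field is classical.
--
-- _⁻¹ and sup are total; nothing is assumed about 0# ⁻¹ or about the sup of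
-- an empty or unbounded set.

record Reals : Set₁ where
  field
    commutativeRing : CommutativeRing 0ℓ 0ℓ

  open CommutativeRing commutativeRing public

  infix 4 _≤_
  infix 8 _⁻¹
  field
    _≤_             : Rel Carrier 0ℓ
    isDecTotalOrder : IsDecTotalOrder _≈_ _≤_
    0≉1             : ¬ (0# ≈ 1#)
    +-monoˡ-≤       : ∀ {x y} z → x ≤ y → x + z ≤ y + z
    *-nonNegative   : ∀ {x y} → 0# ≤ x → 0# ≤ y → 0# ≤ x * y
    _⁻¹             : Carrier → Carrier
    ⁻¹-inverseʳ     : ∀ x → ¬ (x ≈ 0#) → x * x ⁻¹ ≈ 1#

  open ToStrict _≈_ _≤_ public using (_<_)

  UpperBound : Pred Carrier 0ℓ → Pred Carrier 0ℓ
  UpperBound P u = ∀ x → P x → x ≤ u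

  IsSupremum : Pred Carrier 0ℓ → Pred Carrier 0ℓ
  IsSupremum P s = UpperBound P s × (∀ y → y < s → ∃ λ x → P x × y < x)

  field
    sup            : Pred Carrier 0ℓ → Carrier
    sup-isSupremum : ∀ P → ∃ P → ∃ (UpperBound P) → IsSupremum P (sup P)

  totalOrder : TotalOrder 0ℓ 0ℓ 0ℓ
  totalOrder = record { isTotalOrder = IsDecTotalOrder.isTotalOrder isDecTotalOrder }

  open Max totalOrder public using (_⊔_)

  -- _^_ has natural-number exponents.
  open Exp semiring public using (_^_)
  open Mult semiring using () renaming (_×_ to _·_)

  fromℕ : ℕ → Carrier
  fromℕ n = n · 1#

  2# : Carrier
  2# = 1# + 1#

  IsLeast : Pred Carrier 0ℓ → Pred Carrier 0ℓ
  IsLeast P x = P x × (∀ y → P y → x ≤ y)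

  -- 2ᵗ for real t, as the supremum of the reals y ≥ 0 with y ≤ 2^((p - q) / b)
  -- for some rational (p - q) / b ≤ t; both inequalities are written without
  -- division, subtraction or roots.
  exp₂ : Carrier → Carrier
  exp₂ t = sup λ y → 0# ≤ y × ∃ λ p → ∃ λ q → ∃ λ b → NonZero b
    × fromℕ p ≤ fromℕ b * t + fromℕ q
    × y ^ b * 2# ^ q ≤ 2# ^ p

  -- The inverse of exp₂; meaningful for x > 0 only.
  log₂ : Carrier → Carrier
  log₂ x = sup λ t → exp₂ t ≤ x

record Graph (n : ℕ) : Set₁ where
  field
    Adj    : Rel (Fin n) 0ℓ
    adj?   : Decidable Adj
    sym    : Symmetric Adj
    irrefl : Irreflexive _≡_ Adj

module _ {n : ℕ} (G : Graph n) where
  open Graph G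

  edges : List (Fin n × Fin n)
  edges = filter (λ (x , y) → (x Fin.<? y) ×-dec adj? x y)
                 (cartesianProduct (allFin n) (allFin n))

  degree : Fin n → ℕ
  degree x = length (filter (adj? x) (allFin n))

  maxDegree : ℕ
  maxDegree = Extrema.max 0 (map degree (allFin n))

  Connected : Set
  Connected = ∀ x y → Star Adj x y

  IsCycle : Fin n → List (Fin n) → Set
  IsCycle x xs = 2 ℕ.≤ length xs × Unique (x ∷ xs) × Linked Adj (x ∷ xs ++ [ x ])

  Acyclic : Set
  Acyclic = ∀ x xs → ¬ IsCycle x xs

  -- Every graph on Fin n is a spanning subgraph of the complete graph, so
  -- this says that G is a spanning tree of the complete graph.
  IsSpanningTree : Set
  IsSpanningTree = Connected × Acyclic

record FiniteMetricSpace (ℝ : Reals) (n : ℕ) : Set where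
  open Reals ℝ
  field
    d        : Fin n → Fin n → Carrier
    isMetric : IsGeneralMetric _≡_ _≈_ _≤_ 0# _+_ d

module _ {ℝ : Reals} {n : ℕ} (X : FiniteMetricSpace ℝ n) where
  open Reals ℝ
  open FiniteMetricSpace X

  Ball : Fin n → Carrier → Pred (Fin n) 0ℓ
  Ball x r y = d x y ≤ r

  HalfRadiusCover : Fin n → Carrier → Pred (List (Fin n)) 0ℓ
  HalfRadiusCover x r cs = Ball x r ⊆ λ y → Any (λ c → Ball c (r * 2# ⁻¹) y) cs

  IsDoublingDimension : Pred Carrier 0ℓ
  IsDoublingDimension = IsLeast λ t → 0# ≤ t
    × (∀ x r → ∃ λ cs → fromℕ (length cs) ≤ exp₂ t × HalfRadiusCover x r cs)

  weight : Graph n → Carrier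
  weight G = foldr _+_ 0# (map (uncurry d) (edges G))

  IsMSTWeight : Carrier → Set₁
  IsMSTWeight m = (∃ λ T → IsSpanningTree T × weight T ≈ m)
    × (∀ T → IsSpanningTree T → m ≤ weight T)

{-# OPTIONS --safe #-}
module Submission where

-- Trees are parent maps in which the root is its own parent. The weight becomes a sum, over
-- vertices, of distances to parents, so that the exchange and the relinking are both judged one
-- vertex at a time. The price is that the root is one of its own children; it comes first, at
-- distance 0, and this is what makes it keep its place. The degree bound has no additive constant,
-- so the two extra edges and the factors 2 lost in rounding must be absorbed by powers of
-- `exp₂ ddim`. Two distinct points force `exp₂ ddim ≥ 2`, which makes this possible; spaces with at
-- most one point are treated apart. The constant 14 is 2 · 7. After rounding, the bound is M N³
-- with M at most 2 max{1, log(1/ε)} and N at most 2 · `exp₂ ddim`, which leaves seven factors that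
-- are 2 or `exp₂ ddim`. Each is at most y², for a y whose C-th power is at most `exp₂ (C * ddim)`.

-- Root a minimum spanning tree and list the children of each vertex x in the
-- order of increasing distance y₀, y₁, … to x.  Exchanging an edge shows
-- d(yᵢ,yⱼ) ≥ d(x,yᵢ), so by a packing argument at most N² consecutive children
-- can have distances within a factor 2 of each other, where N bounds the number
-- of half-radius balls needed to cover a ball; hence d(x,yᵢ) ≤ ε d(x,yⱼ) for
-- j = i + D and D = N² (⌊log(1/ε)⌋ + 1).  Attach yⱼ to y_{j-D} instead of x whenever
-- j ≥ D.  The edge above yⱼ grows by at most d(x,y_{j-D}) ≤ ε d(x,yⱼ), while a
-- vertex is left with one edge to its new parent, at most one to a later
-- sibling, and at most D to its children.

open import Defs
open import Level using (0ℓ)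
import Algebra.Construct.NaturalChoice.Max as Max
import Algebra.Properties.CommutativeSemiring.Exp as Exp
import Algebra.Properties.Ring as RingProperties
import Algebra.Properties.Semiring.Mult as Mult
import Algebra.Properties.Semiring.Sum as Sum
import Algebra.Solver.Ring.NaturalCoefficients.Default as Solver
open import Data.Fin.Base as Fin using (Fin; zero; suc; toℕ; fromℕ<)
import Data.Fin.Properties as Fin
open import Data.List.Base
  using (List; []; _∷_; [_]; _++_; length; map; filter; foldr; lookup; tabulate; allFin; applyUpTo; concatMap; cartesianProduct)
import Data.List.Extrema as Extrema
import Data.List.Extrema.Nat as Extremaℕ
open import Data.List.Membership.Propositional using (_∈_; find)
open import Data.List.Membership.Propositional.Properties
  using (∈-∃++; ∈-++⁺ˡ; ∈-++⁺ʳ; ∈-++⁻; ∈-map⁺; ∈-map⁻; ∈-filter⁺; ∈-filter⁻; ∈-lookup; ∈-allFin; ∈-applyUpTo⁺; ∈-cartesianProduct⁺)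
open import Data.List.Properties
  using (length-++; length-filter; length-tabulate; length-applyUpTo; map-tabulate; filter-none)
open import Data.List.Relation.Binary.Permutation.Propositional as Perm
  using (_↭_; ↭-refl; ↭-sym; ↭-trans; ↭⇒↭ₛ; prep)
open import Data.List.Relation.Binary.Permutation.Propositional.Properties using (shift; ↭-length; ∈-resp-↭)
import Data.List.Relation.Binary.Permutation.Setoid.Properties as Permutationₛ
open import Data.List.Relation.Binary.Subset.Propositional using (_⊆_)
open import Data.List.Relation.Unary.All as All using (All; []; _∷_)
import Data.List.Relation.Unary.All.Properties as All
open import Data.List.Relation.Unary.AllPairs using ([]; _∷_)
open import Data.List.Relation.Unary.Any as Any using (Any; here; there; index)
open import Data.List.Relation.Unary.Any.Properties using (lookup-index; concatMap⁺)
open import Data.List.Relation.Unary.Linked using (Linked; [-]; _∷_)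
import Data.List.Relation.Unary.Sorted.TotalOrder.Properties as Sorted
open import Data.List.Relation.Unary.Unique.Propositional using (Unique)
import Data.List.Relation.Unary.Unique.Propositional.Properties as Unique
import Data.List.Sort as Sort
open import Data.Nat.Base as ℕ using (ℕ; zero; suc; s≤s; z≤n; NonZero)
open import Data.Nat.Induction using (<-wellFounded)
import Data.Nat.Properties as ℕ
open import Data.Product.Base using (∃; _×_; _,_; proj₁; proj₂; uncurry)
open import Data.Sum.Base using (_⊎_; inj₁; inj₂; [_,_]′; swap)
open import Data.Vec.Functional using (Vector; removeAt; updateAt)
open import Data.Vec.Functional.Properties using (updateAt-updates; updateAt-minimal)
open import Function.Base using (_∘_; const)
open import Function.Metric.Structures using (IsGeneralMetric)
open import Induction.WellFounded using (Acc; acc)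
open import Relation.Binary.Bundles using (DecTotalOrder)
open import Relation.Binary.Construct.Closure.ReflexiveTransitive as Star using (Star; _◅_; _◅◅_)
import Relation.Binary.Construct.On as On
open import Relation.Binary.Core using (Rel)
open import Relation.Binary.PropositionalEquality as ≡ using (_≡_; _≢_; subst; subst₂; ≢-sym)
import Relation.Binary.Reasoning.PartialOrder as PosetReasoning
open import Relation.Nullary using (¬_; yes; no; contradiction)
open import Relation.Nullary.Decidable using (_×-dec_; _⊎-dec_; ¬?; decidable-stable)
open import Relation.Unary using (Pred; Decidable)

-- Ordered fields, exp₂ and log₂

module OrderedField (ℝ : Reals) where
  open Reals ℝ public hiding (zero)

  decTotalOrder : DecTotalOrder 0ℓ 0ℓ 0ℓ
  decTotalOrder = record { isDecTotalOrder = isDecTotalOrder }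

  open DecTotalOrder decTotalOrder public
    using (poset; _≤?_)
    renaming (refl to ≤-refl; trans to ≤-trans; reflexive to ≤-reflexive; total to ≤-total; antisym to ≤-antisym)
  open Solver commutativeSemiring public using (solve; _:=_; _:+_; _:*_)
  module ≤-Reasoning = PosetReasoning poset
  open ≤-Reasoning
  open RingProperties ring using (-‿distribˡ-*; -‿involutive)

  private
    variable
      x y z w : Carrier

  <⇒≤ : x < y → x ≤ y
  <⇒≤ = proj₁

  <⇒≱ : x < y → ¬ (y ≤ x)
  <⇒≱ (x≤y , x≉y) y≤x = x≉y (≤-antisym x≤y y≤x)

  ≰⇒> : ¬ (x ≤ y) → y < x
  ≰⇒> {x} {y} x≰y = [ (λ x≤y → contradiction x≤y x≰y) , (λ y≤x → y≤x , x≰y ∘ ≤-reflexive ∘ sym) ]′ (≤-total x y)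

  +-monoʳ-≤ : ∀ z → x ≤ y → z + x ≤ z + y
  +-monoʳ-≤ {x} {y} z x≤y = begin
    z + x ≈⟨ +-comm z x ⟩
    x + z ≤⟨ +-monoˡ-≤ z x≤y ⟩
    y + z ≈⟨ +-comm y z ⟩
    z + y ∎

  +-mono-≤ : x ≤ y → z ≤ w → x + z ≤ y + w
  +-mono-≤ x≤y z≤w = ≤-trans (+-monoˡ-≤ _ x≤y) (+-monoʳ-≤ _ z≤w)

  +-cancelʳ-≤ : ∀ z → x + z ≤ y + z → x ≤ y
  +-cancelʳ-≤ {x} {y} z h = begin
    x               ≈⟨ cancel x ⟨
    (x + z) + (- z) ≤⟨ +-monoˡ-≤ (- z) h ⟩
    (y + z) + (- z) ≈⟨ cancel y ⟩
    y ∎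
    where
    cancel : ∀ x → (x + z) + (- z) ≈ x
    cancel x = trans (+-assoc _ _ _) (trans (+-congˡ (-‿inverseʳ z)) (+-identityʳ x))

  x≤x+y : 0# ≤ y → x ≤ x + y
  x≤x+y {y} {x} 0≤y = begin
    x      ≈⟨ +-identityʳ x ⟨
    x + 0# ≤⟨ +-monoʳ-≤ x 0≤y ⟩
    x + y  ∎

  +-nonNegative : 0# ≤ x → 0# ≤ y → 0# ≤ x + y
  +-nonNegative 0≤x 0≤y = ≤-trans 0≤x (x≤x+y 0≤y)

  0≤-difference : x ≤ y → 0# ≤ y + (- x)
  0≤-difference {x} {y} x≤y = begin
    0#      ≈⟨ -‿inverseʳ x ⟨
    x + - x ≤⟨ +-monoˡ-≤ (- x) x≤y ⟩
    y + - x ∎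

  *-monoʳ-≤ : ∀ {z} → 0# ≤ z → x ≤ y → z * x ≤ z * y
  *-monoʳ-≤ {x} {y} {z} 0≤z x≤y = begin
    z * x                  ≤⟨ x≤x+y (*-nonNegative 0≤z (0≤-difference x≤y)) ⟩
    z * x + z * (y + - x)  ≈⟨ distribˡ z x _ ⟨
    z * (x + (y + - x))    ≈⟨ *-congˡ (trans (+-congˡ (+-comm _ _)) (trans (sym (+-assoc _ _ _)) (trans (+-congʳ (-‿inverseʳ x)) (+-identityˡ y)))) ⟩
    z * y ∎

  *-monoˡ-≤ : ∀ {z} → 0# ≤ z → x ≤ y → x * z ≤ y * z
  *-monoˡ-≤ {x} {y} {z} 0≤z x≤y = begin
    x * z ≈⟨ *-comm x z ⟩
    z * x ≤⟨ *-monoʳ-≤ 0≤z x≤y ⟩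
    z * y ≈⟨ *-comm z y ⟩
    y * z ∎

  *-mono-≤ : 0# ≤ x → 0# ≤ w → x ≤ y → z ≤ w → x * z ≤ y * w
  *-mono-≤ 0≤x 0≤w x≤y z≤w = ≤-trans (*-monoʳ-≤ 0≤x z≤w) (*-monoˡ-≤ 0≤w x≤y)

  0≤1 : 0# ≤ 1#
  0≤1 with ≤-total 0# 1#
  ... | inj₁ 0≤1 = 0≤1
  ... | inj₂ 1≤0 = begin
    0#          ≤⟨ *-nonNegative 0≤-1 0≤-1 ⟩
    - 1# * - 1# ≈⟨ -‿distribˡ-* 1# (- 1#) ⟨
    - (1# * - 1#) ≈⟨ -‿cong (*-identityˡ _) ⟩
    - - 1#      ≈⟨ -‿involutive 1# ⟩
    1# ∎
    where
    0≤-1 : 0# ≤ - 1#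
    0≤-1 = ≤-trans (0≤-difference 1≤0) (≤-reflexive (+-identityˡ _))

  0<1 : 0# < 1#
  0<1 = 0≤1 , 0≉1

  1≤2 : 1# ≤ 2#
  1≤2 = x≤x+y 0≤1

  0≤2 : 0# ≤ 2#
  0≤2 = ≤-trans 0≤1 1≤2

  0<2 : 0# < 2#
  0<2 = 0≤2 , λ 0≈2 → 0≉1 (≤-antisym 0≤1 (≤-trans 1≤2 (≤-reflexive (sym 0≈2))))

  >⇒≉ : 0# < x → ¬ (x ≈ 0#)
  >⇒≉ (_ , 0≉x) x≈0 = 0≉x (sym x≈0)

  *-cancelˡ-≤ : ∀ {z} → 0# < z → z * x ≤ z * y → x ≤ y
  *-cancelˡ-≤ {x} {y} {z} 0<z zx≤zy with ≤-total x y
  ... | inj₁ x≤y = x≤y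
  -- The sign of `z ⁻¹` is still unknown, as `0≤⁻¹` rests on this lemma. So the two products are
  -- first shown equal, and only then is `z` cancelled.
  ... | inj₂ y≤x = ≤-reflexive (begin-equality
    x              ≈⟨ *-identityˡ x ⟨
    1# * x         ≈⟨ *-congʳ z⁻¹z ⟨
    z ⁻¹ * z * x   ≈⟨ *-assoc _ _ _ ⟩
    z ⁻¹ * (z * x) ≈⟨ *-congˡ (≤-antisym zx≤zy (*-monoʳ-≤ (<⇒≤ 0<z) y≤x)) ⟩
    z ⁻¹ * (z * y) ≈⟨ *-assoc _ _ _ ⟨
    z ⁻¹ * z * y   ≈⟨ *-congʳ z⁻¹z ⟩
    1# * y         ≈⟨ *-identityˡ y ⟩
    y              ∎)
    where
    z⁻¹z : z ⁻¹ * z ≈ 1#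
    z⁻¹z = trans (*-comm _ _) (⁻¹-inverseʳ z (>⇒≉ 0<z))

  0≤⁻¹ : 0# < x → 0# ≤ x ⁻¹
  0≤⁻¹ {x} 0<x = *-cancelˡ-≤ 0<x (begin
    x * 0#   ≈⟨ zeroʳ x ⟩
    0#       ≤⟨ 0≤1 ⟩
    1#       ≈⟨ ⁻¹-inverseʳ x (>⇒≉ 0<x) ⟨
    x * x ⁻¹ ∎)

  ½ : Carrier
  ½ = 2# ⁻¹

  0≤½ : 0# ≤ ½
  0≤½ = 0≤⁻¹ 0<2

  2*½ : 2# * ½ ≈ 1#
  2*½ = ⁻¹-inverseʳ 2# (>⇒≉ 0<2)

  x½+x½ : ∀ x → x * ½ + x * ½ ≈ x
  x½+x½ x = begin-equality
    x * ½ + x * ½             ≈⟨ distribˡ x ½ ½ ⟨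
    x * (½ + ½)               ≈⟨ *-congˡ (+-cong (*-identityˡ ½) (*-identityˡ ½)) ⟨
    x * (1# * ½ + 1# * ½)     ≈⟨ *-congˡ (distribʳ ½ 1# 1#) ⟨
    x * (2# * ½)              ≈⟨ *-congˡ 2*½ ⟩
    x * 1#       ≈⟨ *-identityʳ x ⟩
    x ∎

  *-positive : 0# < x → 0# < y → 0# < x * y
  *-positive {x} {y} 0<x 0<y = ≰⇒> λ xy≤0 → <⇒≱ 0<y (*-cancelˡ-≤ 0<x (≤-trans xy≤0 (≤-reflexive (sym (zeroʳ x)))))

  0≤^ : ∀ n → 0# ≤ x → 0# ≤ x ^ n
  0≤^ zero 0≤x = 0≤1
  0≤^ (suc n) 0≤x = *-nonNegative 0≤x (0≤^ n 0≤x)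

  0<^ : ∀ n → 0# < x → 0# < x ^ n
  0<^ zero 0<x = 0<1
  0<^ (suc n) 0<x = *-positive 0<x (0<^ n 0<x)

  ^-mono-≤ : ∀ n → 0# ≤ x → x ≤ y → x ^ n ≤ y ^ n
  ^-mono-≤ zero 0≤x x≤y = ≤-refl
  ^-mono-≤ (suc n) 0≤x x≤y = *-mono-≤ 0≤x (0≤^ n (≤-trans 0≤x x≤y)) x≤y (^-mono-≤ n 0≤x x≤y)

  1≤^ : ∀ n → 1# ≤ x → 1# ≤ x ^ n
  1≤^ zero 1≤x = ≤-refl
  1≤^ {x} (suc n) 1≤x = begin
    1#        ≈⟨ *-identityˡ 1# ⟨
    1# * 1#   ≤⟨ *-mono-≤ 0≤1 (0≤^ n (≤-trans 0≤1 1≤x)) 1≤x (1≤^ n 1≤x) ⟩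
    x * x ^ n ∎

-- The archimedean property, `exp₂` and `log₂`

module Exponential (ℝ : Reals) where
  open OrderedField ℝ public
  open ≤-Reasoning
  open Mult semiring public using (×-homo-+; ×1-homo-*)
  open Exp commutativeSemiring public using (^-homo-*; ^-assocʳ; ^-distrib-*)

  private
    variable
      x y z w : Carrier

  0≤fromℕ : ∀ n → 0# ≤ fromℕ n
  0≤fromℕ zero = ≤-refl
  0≤fromℕ (suc n) = +-nonNegative 0≤1 (0≤fromℕ n)

  fromℕ-mono-≤ : ∀ {m n} → m ℕ.≤ n → fromℕ m ≤ fromℕ n
  fromℕ-mono-≤ {n = n} z≤n = 0≤fromℕ n
  fromℕ-mono-≤ (s≤s m≤n) = +-monoʳ-≤ 1# (fromℕ-mono-≤ m≤n)

  fromℕ-cancel-≤ : ∀ {m n} → fromℕ m ≤ fromℕ n → m ℕ.≤ n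
  fromℕ-cancel-≤ {m} {n} m≤n with m ℕ.≤? n
  ... | yes p = p
  ... | no m≰n = contradiction 1≤0 (<⇒≱ 0<1)
    where
    1≤0 : 1# ≤ 0#
    1≤0 = +-cancelʳ-≤ (fromℕ n) (begin
      fromℕ (suc n)   ≤⟨ fromℕ-mono-≤ (ℕ.≰⇒> m≰n) ⟩
      fromℕ m         ≤⟨ m≤n ⟩
      fromℕ n         ≈⟨ +-identityˡ _ ⟨
      0# + fromℕ n    ∎)

  fromℕ-1 : fromℕ 1 ≈ 1#
  fromℕ-1 = +-identityʳ 1#

  fromℕ-2^ : ∀ n → fromℕ (2 ℕ.^ n) ≈ 2# ^ n
  fromℕ-2^ zero = fromℕ-1
  fromℕ-2^ (suc n) = begin-equality
    fromℕ (2 ℕ.* 2 ℕ.^ n)       ≈⟨ ×1-homo-* 2 (2 ℕ.^ n) ⟩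
    fromℕ 2 * fromℕ (2 ℕ.^ n)   ≈⟨ *-cong (+-congˡ fromℕ-1) (fromℕ-2^ n) ⟩
    2# * 2# ^ n                 ∎

  ^-monoʳ-≤ : 1# ≤ x → ∀ {m n} → m ℕ.≤ n → x ^ m ≤ x ^ n
  ^-monoʳ-≤ 1≤x {n = n} z≤n = 1≤^ n 1≤x
  ^-monoʳ-≤ 1≤x (s≤s m≤n) = *-monoʳ-≤ (≤-trans 0≤1 1≤x) (^-monoʳ-≤ 1≤x m≤n)

  *-cancelʳ-≤ : 0# < z → x * z ≤ y * z → x ≤ y
  *-cancelʳ-≤ {z} {x} {y} 0<z xz≤yz = *-cancelˡ-≤ 0<z (begin
    z * x ≈⟨ *-comm z x ⟩
    x * z ≤⟨ xz≤yz ⟩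
    y * z ≈⟨ *-comm y z ⟩
    z * y ∎)

  ^-cancelˡ-≤ : ∀ n .{{_ : NonZero n}} → 0# ≤ y → x ^ n ≤ y ^ n → x ≤ y
  ^-cancelˡ-≤ {y} {x} (suc n) 0≤y xⁿ≤yⁿ with x ≤? y
  ... | yes x≤y = x≤y
  ... | no x≰y = *-cancelʳ-≤ (0<^ n 0<x) (begin
    x * x ^ n ≤⟨ xⁿ≤yⁿ ⟩
    y * y ^ n ≤⟨ *-monoʳ-≤ 0≤y (^-mono-≤ n 0≤y (<⇒≤ (≰⇒> x≰y))) ⟩
    y * x ^ n ∎)
    where
    0<x : 0# < x
    0<x = ≰⇒> λ x≤0 → x≰y (≤-trans x≤0 0≤y)

  sup-upper : ∀ {P : Pred Carrier 0ℓ} → ∃ P → ∃ (UpperBound P) → UpperBound P (sup P)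
  sup-upper {P} p b = proj₁ (sup-isSupremum P p b)

  x½<x : 0# < x → x * ½ < x
  x½<x {x} 0<x = ≰⇒> λ x≤x½ → <⇒≱ 0<x (≤-trans (≤-reflexive (sym (x½+x½ x)))
    (≤-trans (+-mono-≤ (x½≤0 x≤x½) (x½≤0 x≤x½)) (≤-reflexive (+-identityˡ 0#))))
    where
    x½≤0 : x ≤ x * ½ → x * ½ ≤ 0#
    x½≤0 x≤x½ = +-cancelʳ-≤ (x * ½) (begin
      x * ½ + x * ½ ≈⟨ x½+x½ x ⟩
      x             ≤⟨ x≤x½ ⟩
      x * ½         ≈⟨ +-identityˡ _ ⟨
      0# + x * ½    ∎)

  -- The powers of 2 below `a` have a supremum. One of them exceeds half of it, so its double
  -- exceeds the supremum and cannot be below `a`. Completeness is used directly here, and the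
  -- archimedean property is deduced afterwards.
  dyadicFloor : ∀ a → 1# ≤ a → ∃ λ m → 2# ^ m ≤ a × a < 2# ^ suc m
  dyadicFloor a 1≤a = proj₁ power , proj₂ (proj₂ power) , ≰⇒> 2ᵐ⁺¹≰a
    where
    PowersBelow : Pred Carrier 0ℓ
    PowersBelow z = ∃ λ m → z ≈ 2# ^ m × 2# ^ m ≤ a
    s : Carrier
    s = sup PowersBelow
    nonempty : ∃ PowersBelow
    nonempty = 1# , 0 , refl , 1≤a
    bounded : ∃ (UpperBound PowersBelow)
    bounded = a , λ z (_ , z≈2ᵐ , 2ᵐ≤a) → ≤-trans (≤-reflexive z≈2ᵐ) 2ᵐ≤a
    2ᵐ≤s : ∀ m → 2# ^ m ≤ a → 2# ^ m ≤ s
    2ᵐ≤s m 2ᵐ≤a = sup-upper nonempty bounded _ (m , refl , 2ᵐ≤a)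
    0<s : 0# < s
    0<s = ≰⇒> λ s≤0 → <⇒≱ 0<1 (≤-trans (2ᵐ≤s 0 1≤a) s≤0)
    power : ∃ λ m → s * ½ < 2# ^ m × 2# ^ m ≤ a
    power with proj₂ (sup-isSupremum PowersBelow nonempty bounded) (s * ½) (x½<x 0<s)
    ... | z , (m , z≈2ᵐ , 2ᵐ≤a) , s½<z = m , ≰⇒> (λ 2ᵐ≤s½ → <⇒≱ s½<z (≤-trans (≤-reflexive z≈2ᵐ) 2ᵐ≤s½)) , 2ᵐ≤a
    2ᵐ⁺¹≰a : ¬ (2# ^ suc (proj₁ power) ≤ a)
    2ᵐ⁺¹≰a 2ᵐ⁺¹≤a = <⇒≱ (proj₁ (proj₂ power)) (*-cancelˡ-≤ 0<2 (begin
      2# ^ suc (proj₁ power)  ≤⟨ 2ᵐ≤s (suc (proj₁ power)) 2ᵐ⁺¹≤a ⟩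
      s                       ≈⟨ *-identityʳ s ⟨
      s * 1#                  ≈⟨ *-congˡ 2*½ ⟨
      s * (2# * ½)            ≈⟨ *-assoc s 2# ½ ⟨
      s * 2# * ½              ≈⟨ *-congʳ (*-comm s 2#) ⟩
      2# * s * ½              ≈⟨ *-assoc 2# s ½ ⟩
      2# * (s * ½)            ∎))

  archimedean : ∀ t → ∃ λ N → t ≤ fromℕ N
  archimedean t with ≤-total t 1#
  ... | inj₁ t≤1 = 1 , ≤-trans t≤1 (≤-reflexive (sym fromℕ-1))
  ... | inj₂ 1≤t = let m , _ , t<2ᵐ = dyadicFloor t 1≤t in
    2 ℕ.^ suc m , ≤-trans (<⇒≤ t<2ᵐ) (≤-reflexive (sym (fromℕ-2^ (suc m))))

  -- exp₂ t unfolds to sup (BelowExp₂ t).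
  BelowExp₂ : Carrier → Pred Carrier 0ℓ
  BelowExp₂ t y = 0# ≤ y × ∃ λ p → ∃ λ q → ∃ λ b → NonZero b
    × fromℕ p ≤ fromℕ b * t + fromℕ q
    × y ^ b * 2# ^ q ≤ 2# ^ p

  -- An integer bound on `t` turns `p ≤ b t + q` into an inequality between natural numbers; then
  -- `2# ^ q` cancels and a `b`-th root can be taken.
  BelowExp₂-bound : ∀ {t} N → t ≤ fromℕ N → UpperBound (BelowExp₂ t) (2# ^ N)
  BelowExp₂-bound {t} N t≤N y (0≤y , p , q , b , b≢0 , p≤bt+q , yᵇ2^q≤2^p) =
    ^-cancelˡ-≤ b {{b≢0}} (0≤^ N 0≤2) (*-cancelʳ-≤ (0<^ q 0<2) (begin
      y ^ b * 2# ^ q            ≤⟨ yᵇ2^q≤2^p ⟩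
      2# ^ p                    ≤⟨ ^-monoʳ-≤ 1≤2 p≤Nb+q ⟩
      2# ^ (N ℕ.* b ℕ.+ q)      ≈⟨ ^-homo-* 2# (N ℕ.* b) q ⟩
      2# ^ (N ℕ.* b) * 2# ^ q   ≈⟨ *-congʳ (^-assocʳ 2# N b) ⟨
      (2# ^ N) ^ b * 2# ^ q     ∎))
    where
    p≤Nb+q : p ℕ.≤ N ℕ.* b ℕ.+ q
    p≤Nb+q = fromℕ-cancel-≤ (begin
      fromℕ p                          ≤⟨ p≤bt+q ⟩
      fromℕ b * t + fromℕ q            ≤⟨ +-monoˡ-≤ _ (*-monoʳ-≤ (0≤fromℕ b) t≤N) ⟩
      fromℕ b * fromℕ N + fromℕ q      ≈⟨ +-congʳ (*-comm _ _) ⟩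
      fromℕ N * fromℕ b + fromℕ q      ≈⟨ +-congʳ (×1-homo-* N b) ⟨
      fromℕ (N ℕ.* b) + fromℕ q        ≈⟨ ×-homo-+ 1# (N ℕ.* b) q ⟨
      fromℕ (N ℕ.* b ℕ.+ q)            ∎)

  BelowExp₂-bounded : ∀ t → ∃ (UpperBound (BelowExp₂ t))
  BelowExp₂-bounded t with archimedean t
  ... | N , t≤N = _ , BelowExp₂-bound N t≤N

  ≤exp₂ : ∀ {t y} → BelowExp₂ t y → y ≤ exp₂ t
  ≤exp₂ {t} {y} y∈ = sup-upper (y , y∈) (BelowExp₂-bounded t) y y∈

  BelowExp₂-0 : ∀ {t} → 0# ≤ t → BelowExp₂ t 0#
  BelowExp₂-0 {t} 0≤t = ≤-refl , 0 , 0 , 1 , _ , +-nonNegative (*-nonNegative (0≤fromℕ 1) 0≤t) ≤-refl , (begin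
    0# ^ 1 * 1#  ≈⟨ *-congʳ (zeroˡ _) ⟩
    0# * 1#      ≈⟨ zeroˡ _ ⟩
    0#           ≤⟨ 0≤1 ⟩
    1#           ∎)

  approximateExp₂ : ∀ {t} → 0# ≤ t → y < exp₂ t → ∃ λ z → BelowExp₂ t z × y < z
  approximateExp₂ {y} {t} 0≤t y< = proj₂ (sup-isSupremum _ (0# , BelowExp₂-0 0≤t) (BelowExp₂-bounded t)) y y<

  BelowExp₂-≤ : ∀ {t} N → fromℕ N ≤ t → BelowExp₂ t (2# ^ N)
  BelowExp₂-≤ {t} N N≤t = 0≤^ N 0≤2 , N , 0 , 1 , _ , (begin
      fromℕ N              ≤⟨ N≤t ⟩
      t                    ≈⟨ *-identityˡ t ⟨
      1# * t               ≈⟨ *-congʳ fromℕ-1 ⟨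
      fromℕ 1 * t          ≈⟨ +-identityʳ _ ⟨
      fromℕ 1 * t + 0#     ∎)
    , ≤-reflexive (trans (*-identityʳ _) (*-identityʳ _))

  -- `p` and `q` are multiplied by `C` while the denominator `b` stays. This stands in for the law
  -- (2ᵗ)^C = 2^(Ct).
  BelowExp₂-^ : ∀ {t y} C → BelowExp₂ t y → BelowExp₂ (fromℕ C * t) (y ^ C)
  BelowExp₂-^ {t} {y} C (0≤y , p , q , b , b≢0 , p≤bt+q , yᵇ2^q≤2^p) =
    0≤^ C 0≤y , p ℕ.* C , q ℕ.* C , b , b≢0 , (begin
      fromℕ (p ℕ.* C)                              ≈⟨ ×1-homo-* p C ⟩
      fromℕ p * fromℕ C                            ≤⟨ *-monoˡ-≤ (0≤fromℕ C) p≤bt+q ⟩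
      (fromℕ b * t + fromℕ q) * fromℕ C            ≈⟨ solve 4 (λ b t q C → (b :* t :+ q) :* C := b :* (C :* t) :+ q :* C) refl _ _ _ _ ⟩
      fromℕ b * (fromℕ C * t) + fromℕ q * fromℕ C  ≈⟨ +-congˡ (×1-homo-* q C) ⟨
      fromℕ b * (fromℕ C * t) + fromℕ (q ℕ.* C)    ∎)
    , (begin
      (y ^ C) ^ b * 2# ^ (q ℕ.* C)    ≈⟨ *-cong (^-assocʳ y C b) (sym (^-assocʳ 2# q C)) ⟩
      y ^ (C ℕ.* b) * (2# ^ q) ^ C    ≡⟨ ≡.cong (λ e → y ^ e * (2# ^ q) ^ C) (ℕ.*-comm C b) ⟩
      y ^ (b ℕ.* C) * (2# ^ q) ^ C    ≈⟨ *-congʳ (^-assocʳ y b C) ⟨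
      (y ^ b) ^ C * (2# ^ q) ^ C      ≈⟨ ^-distrib-* _ _ C ⟨
      (y ^ b * 2# ^ q) ^ C            ≤⟨ ^-mono-≤ C (*-nonNegative (0≤^ b 0≤y) (0≤^ q 0≤2)) yᵇ2^q≤2^p ⟩
      (2# ^ p) ^ C                    ≈⟨ ^-assocʳ 2# p C ⟩
      2# ^ (p ℕ.* C)                  ∎)

  -- The supremum exp₂ t need not be attained a priori; three quarters of it
  -- is exceeded, and squaring makes up for the loss because exp₂ t ≥ 2.
  exp₂-root : ∀ {t} → 0# ≤ t → 2# ≤ exp₂ t →
    ∃ λ y → exp₂ t ≤ y ^ 2 × (∀ C → y ^ C ≤ exp₂ (fromℕ C * t))
  exp₂-root {t} 0≤t 2≤L = proj₁ approximation , L≤r² , λ C → ≤exp₂ (BelowExp₂-^ C (proj₁ (proj₂ approximation)))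
    where
    L q : Carrier
    L = exp₂ t
    q = L * ½ * ½
    4q : (q + q) + (q + q) ≈ L
    4q = trans (+-cong (x½+x½ _) (x½+x½ _)) (x½+x½ L)
    1≤2q : 1# ≤ q + q
    1≤2q = begin
      1#      ≈⟨ 2*½ ⟨
      2# * ½  ≤⟨ *-monoˡ-≤ 0≤½ 2≤L ⟩
      L * ½   ≈⟨ x½+x½ _ ⟨
      q + q   ∎
    0<q : 0# < q
    0<q = ≰⇒> λ q≤0 → <⇒≱ 0<1 (≤-trans 1≤2q (≤-trans (+-mono-≤ q≤0 q≤0) (≤-reflexive (+-identityˡ 0#))))
    0≤q : 0# ≤ q
    0≤q = <⇒≤ 0<q
    0≤3q : 0# ≤ q + q + q
    0≤3q = +-nonNegative (+-nonNegative 0≤q 0≤q) 0≤q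
    3q<L : q + q + q < L
    3q<L = ≰⇒> λ L≤3q → <⇒≱ 0<q (+-cancelʳ-≤ (q + q + q) (begin
      q + (q + q + q)    ≈⟨ solve 1 (λ q → q :+ (q :+ q :+ q) := (q :+ q) :+ (q :+ q)) refl q ⟩
      (q + q) + (q + q)  ≈⟨ 4q ⟩
      L                  ≤⟨ L≤3q ⟩
      q + q + q          ≈⟨ +-identityˡ _ ⟨
      0# + (q + q + q)   ∎))
    approximation : ∃ λ y → BelowExp₂ t y × q + q + q < y
    approximation = approximateExp₂ 0≤t 3q<L
    r : Carrier
    r = proj₁ approximation
    3q≤r : q + q + q ≤ r
    3q≤r = <⇒≤ (proj₂ (proj₂ approximation))
    L≤r² : L ≤ r ^ 2
    L≤r² = begin
      L                                       ≈⟨ *-identityˡ L ⟨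
      1# * L                                  ≤⟨ *-monoˡ-≤ (≤-trans 0≤2 2≤L) 1≤2q ⟩
      (q + q) * L                             ≈⟨ *-congˡ 4q ⟨
      (q + q) * ((q + q) + (q + q))           ≤⟨ x≤x+y (*-nonNegative 0≤q 0≤q) ⟩
      (q + q) * ((q + q) + (q + q)) + q * q
        ≈⟨ solve 1 (λ q → (q :+ q) :* ((q :+ q) :+ (q :+ q)) :+ q :* q := (q :+ q :+ q) :* (q :+ q :+ q)) refl q ⟩
      (q + q + q) * (q + q + q)               ≤⟨ *-mono-≤ 0≤3q (≤-trans 0≤3q 3q≤r) 3q≤r 3q≤r ⟩
      r * r                                   ≈⟨ *-congˡ (*-identityʳ r) ⟨
      r ^ 2                                   ∎

  -- A supremum is known to bound its set only once the set is nonempty and bounded. It contains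
  -- `k`, because no element of the set behind `exp₂ k` exceeds `2# ^ k`; and any `t` above `m + 1`
  -- would give `exp₂ t ≥ 2^(m+1) > a`.
  ≤log₂ : ∀ k {a} → 2# ^ k ≤ a → fromℕ k ≤ log₂ a
  ≤log₂ k {a} 2ᵏ≤a = sup-upper (fromℕ k , k∈) (fromℕ (suc m) , bound) (fromℕ k) k∈
    where
    1≤a : 1# ≤ a
    1≤a = ≤-trans (1≤^ k 1≤2) 2ᵏ≤a
    power : ∃ λ m → 2# ^ m ≤ a × a < 2# ^ suc m
    power = dyadicFloor a 1≤a
    m : ℕ
    m = proj₁ power
    k∈ : exp₂ (fromℕ k) ≤ a
    k∈ with exp₂ (fromℕ k) ≤? 2# ^ k
    ... | yes e≤2ᵏ = ≤-trans e≤2ᵏ 2ᵏ≤a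
    ... | no e≰2ᵏ with approximateExp₂ (0≤fromℕ k) (≰⇒> e≰2ᵏ)
    ...   | z , z∈ , 2ᵏ<z = contradiction (BelowExp₂-bound k ≤-refl z z∈) (<⇒≱ 2ᵏ<z)
    bound : ∀ t → exp₂ t ≤ a → t ≤ fromℕ (suc m)
    bound t e≤a with ≤-total t (fromℕ (suc m))
    ... | inj₁ t≤m = t≤m
    ... | inj₂ m≤t = contradiction (≤-trans (≤exp₂ (BelowExp₂-≤ (suc m) m≤t)) e≤a)
                       (<⇒≱ (proj₂ (proj₂ power)))

-- Rooted trees

-- Splitting off the remainder `zs` makes both lengths and sums of nonnegative terms monotone under
-- inclusion: the former bounds degrees, the latter weights.
Unique∧⊆⇒↭ : ∀ {A : Set} {xs ys : List A} → Unique xs → xs ⊆ ys → ∃ λ zs → ys ↭ xs ++ zs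
Unique∧⊆⇒↭ {xs = []} _ _ = _ , ↭-refl
Unique∧⊆⇒↭ {xs = x ∷ xs} {ys} (x∉xs ∷ xs!) xs⊆ys with ∈-∃++ (xs⊆ys (here ≡.refl))
... | as , bs , ≡.refl with Unique∧⊆⇒↭ xs! xs⊆
  where
  xs⊆ : xs ⊆ as ++ bs
  xs⊆ z∈xs with ∈-++⁻ as (xs⊆ys (there z∈xs))
  ... | inj₁ z∈as = ∈-++⁺ˡ z∈as
  ... | inj₂ (here ≡.refl) = contradiction ≡.refl (All.lookup x∉xs z∈xs)
  ... | inj₂ (there z∈bs) = ∈-++⁺ʳ as z∈bs
... | zs , ρ = zs , ↭-trans (shift x as bs) (prep x ρ)

Unique∧⊆⇒length≤ : ∀ {A : Set} {xs ys : List A} → Unique xs → xs ⊆ ys → length xs ℕ.≤ length ys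
Unique∧⊆⇒length≤ {xs = xs} {ys} xs! xs⊆ys with Unique∧⊆⇒↭ xs! xs⊆ys
... | zs , ρ = subst (length xs ℕ.≤_) (≡.sym (≡.trans (↭-length ρ) (length-++ xs))) (ℕ.m≤m+n _ _)

least : {P : Pred ℕ 0ℓ} → Decidable P → ∀ k → P k → ∃ λ m → P m × (∀ {j} → P j → m ℕ.≤ j)
least P? k pk with P? 0
... | yes p₀ = 0 , p₀ , λ _ → z≤n
least P? zero pk | no ¬p₀ = contradiction pk ¬p₀
least P? (suc k) pk | no ¬p₀ with least (P? ∘ suc) k pk
... | m , pm , min = suc m , pm , λ { {zero} p₀ → contradiction p₀ ¬p₀ ; {suc j} pj → s≤s (min pj) }

module _ {A : Set} (_~_ : Rel A 0ℓ) where

  -- The indices are the first two and the last two vertices of the walk.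
  data NonBacktracking (u v : A) : A → A → Set where
    stop : u ~ v → NonBacktracking u v u v
    step : ∀ {w a b} → u ~ v → u ≢ w → NonBacktracking v w a b → NonBacktracking u v a b

  firstEdge : ∀ {u v a b} → NonBacktracking u v a b → u ~ v
  firstEdge (stop e) = e
  firstEdge (step e _ _) = e

  -- For opening a cycle into a walk that never turns straight back. That the last vertex but one is
  -- in `v ∷ zs`, hence different from `u`, is what later excludes a walk that goes up an edge and
  -- comes back down it.
  Linked⇒NonBacktracking : ∀ {u v b} zs → Linked _~_ (u ∷ v ∷ zs ++ [ b ]) → Unique (u ∷ v ∷ zs) →
    u ≢ b → All (_≢ b) (v ∷ zs) → ∃ λ a → a ∈ v ∷ zs × NonBacktracking u v a b
  Linked⇒NonBacktracking [] (uv ∷ vb ∷ [-]) _ u≢b _ = _ , here ≡.refl , step uv u≢b (stop vb)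
  Linked⇒NonBacktracking (z ∷ zs) (uv ∷ vzs) ((_ ∷ u≢z ∷ _) ∷ vzs!) _ (v≢b ∷ zs≢b)
    with Linked⇒NonBacktracking zs vzs vzs! v≢b zs≢b
  ... | a , a∈ , walk = a , there a∈ , step uv u≢z walk

-- The rank may be any measure that decreases towards the root, so relinking can supply one of its
-- own (`rank′`). Making the root its own parent keeps `parent` total and adds a term of length 0 to
-- the sum of distances.
record RootedTree (n : ℕ) : Set where
  field
    root        : Fin n
    parent      : Fin n → Fin n
    rank        : Fin n → ℕ
    parent-root : parent root ≡ root
    rank-parent : ∀ {v} → v ≢ root → rank (parent v) ℕ.< rank v

  _⇄_ : Rel (Fin n) 0ℓ
  u ⇄ v = u ≢ v × (parent u ≡ v ⊎ parent v ≡ u)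

  graph : Graph n
  graph = record
    { Adj    = _⇄_
    ; adj?   = λ u v → ¬? (u Fin.≟ v) ×-dec ((parent u Fin.≟ v) ⊎-dec (parent v Fin.≟ u))
    ; sym    = λ (u≢v , uv) → ≢-sym u≢v , swap uv
    ; irrefl = λ u≡v (u≢v , _) → u≢v u≡v
    }

  fixed⇒root : ∀ {v} → parent v ≡ v → v ≡ root
  fixed⇒root {v} pv≡v with v Fin.≟ root
  ... | yes v≡r = v≡r
  ... | no v≢r = contradiction (≡.cong rank pv≡v) (ℕ.<⇒≢ (rank-parent v≢r))

  ≢root : ∀ {u v} → u ≢ v → parent u ≡ v → u ≢ root
  ≢root u≢v pu≡v ≡.refl = u≢v (≡.trans (≡.sym parent-root) pu≡v)

  connected : Connected graph
  connected x y = toRoot x (<-wellFounded _) ◅◅ Star.reverse (Graph.sym graph) (toRoot y (<-wellFounded _))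
    where
    toRoot : ∀ v → Acc ℕ._<_ (rank v) → Star _⇄_ v root
    toRoot v (acc rec) with v Fin.≟ root
    ... | yes ≡.refl = Star.ε
    ... | no v≢r = ((λ v≡pv → v≢r (fixed⇒root (≡.sym v≡pv))) , inj₁ ≡.refl) ◅ toRoot _ (rec (rank-parent v≢r))

  -- The only edge going up is the one just used, so the walk keeps going down.
  walk-down : ∀ {u v a b} → NonBacktracking _⇄_ u v a b → parent v ≡ u →
    rank u ℕ.< rank b × parent b ≡ a
  walk-down (stop (u≢v , _)) ≡.refl = rank-parent (≢root (≢-sym u≢v) ≡.refl) , ≡.refl
  walk-down (step (u≢v , _) u≢w walk) ≡.refl with firstEdge _⇄_ walk
  ... | _ , inj₁ pv≡w = contradiction pv≡w u≢w
  ... | _ , inj₂ pw≡v with walk-down walk pw≡v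
  ...   | v<b , pb = ℕ.<-trans (rank-parent (≢root (≢-sym u≢v) ≡.refl)) v<b , pb

  -- Such a walk either climbs to its end, or turns down once; from there on `walk-down` applies.
  walk-up : ∀ {u v a b} → NonBacktracking _⇄_ u v a b → parent u ≡ v →
    rank b ℕ.< rank u ⊎ parent b ≡ a
  walk-up (stop (u≢v , _)) ≡.refl = inj₁ (rank-parent (≢root u≢v ≡.refl))
  walk-up (step (u≢v , _) _ walk) ≡.refl with firstEdge _⇄_ walk
  ... | _ , inj₂ pw≡v = inj₂ (proj₂ (walk-down walk pw≡v))
  ... | _ , inj₁ pv≡w with walk-up walk pv≡w
  ...   | inj₁ b<v = inj₁ (ℕ.<-trans b<v (rank-parent (≢root u≢v ≡.refl)))
  ...   | inj₂ pb = inj₂ pb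

  -- A cycle that starts downwards would give `x` a rank below itself. One that starts upwards must
  -- return to `x` from its parent, which is `y`, so `y` would occur twice.
  acyclic : Acyclic graph
  acyclic x (y ∷ z ∷ zs) (_ , (x∉ ∷ y∉ ∷ zs!) , (xy ∷ yzs))
    with Linked⇒NonBacktracking _⇄_ zs yzs (y∉ ∷ zs!)
           (≢-sym (All.head x∉)) (All.map ≢-sym (All.tail x∉))
  ... | a , a∈zs , walk = absurd (proj₂ xy)
    where
    cycle : NonBacktracking _⇄_ x y a x
    cycle = step xy (All.lookup x∉ (there (here ≡.refl))) walk
    absurd : ¬ (parent x ≡ y ⊎ parent y ≡ x)
    absurd (inj₂ py≡x) = ℕ.<-irrefl ≡.refl (proj₁ (walk-down cycle py≡x))
    absurd (inj₁ px≡y) with walk-up cycle px≡y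
    ... | inj₁ x<x = ℕ.<-irrefl ≡.refl x<x
    ... | inj₂ px≡a = All.lookup y∉ a∈zs (≡.trans (≡.sym px≡y) px≡a)
  acyclic x [] (() , _)
  acyclic x (_ ∷ []) (s≤s () , _)

  isSpanningTree : IsSpanningTree graph
  isSpanningTree = connected , acyclic

-- Any vertex from which the root is reached along parents has a depth, so
-- well-foundedness may be established without exhibiting a rank.
module _ {n} (root : Fin n) (parent : Fin n → Fin n) where

  data ReachesRoot : Fin n → Set where
    here  : ReachesRoot root
    above : ∀ {v} → v ≢ root → ReachesRoot (parent v) → ReachesRoot v

  depth : ∀ {v} → ReachesRoot v → ℕ
  depth here = 0
  depth (above _ q) = suc (depth q)

  depth-irrelevant : ∀ {v} (q q′ : ReachesRoot v) → depth q ≡ depth q′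
  depth-irrelevant here here = ≡.refl
  depth-irrelevant here (above r≢r _) = contradiction ≡.refl r≢r
  depth-irrelevant (above r≢r _) here = contradiction ≡.refl r≢r
  depth-irrelevant (above _ q) (above _ q′) = ≡.cong suc (depth-irrelevant q q′)

  rootedTree : parent root ≡ root → (∀ v → ReachesRoot v) → RootedTree n
  rootedTree pr reaches = record
    { root = root ; parent = parent ; rank = λ v → depth (reaches v) ; parent-root = pr
    ; rank-parent = decreasing (reaches _)
    }
    where
    decreasing : ∀ {v} (q : ReachesRoot v) → v ≢ root → depth (reaches (parent v)) ℕ.< depth (reaches v)
    decreasing here r≢r = contradiction ≡.refl r≢r
    decreasing q@(above _ q′) _ =
      subst₂ ℕ._<_ (depth-irrelevant q′ _) (depth-irrelevant q _) (ℕ.n<1+n _)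

module _ {n} (P : RootedTree n) where
  open RootedTree P

  -- Recursion on the old rank still reaches the root from `y`: two new steps, through `z`, lead to
  -- the common parent, whose old rank is smaller.
  reattachTree : ∀ {y z} → y ≢ root → z ≢ root → z ≢ y → parent z ≡ parent y →
    ∃ λ (P′ : RootedTree n) → RootedTree.parent P′ ≡ updateAt parent y (const z)
  reattachTree {y} {z} y≢r z≢r z≢y pz≡py =
    rootedTree root p′ (≡.trans (elsewhere (≢-sym y≢r)) parent-root) (λ v → reach v (<-wellFounded _)) , ≡.refl
    where
    p′ : Fin n → Fin n
    p′ = updateAt parent y (const z)
    elsewhere : ∀ {v} → v ≢ y → p′ v ≡ parent v
    elsewhere {v} v≢y = updateAt-minimal v y parent v≢y
    reach : ∀ v → Acc ℕ._<_ (rank v) → ReachesRoot root p′ v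
    reach v (acc rec) with v Fin.≟ root
    ... | yes ≡.refl = here
    ... | no v≢r with v Fin.≟ y
    ...   | no v≢y = above v≢r (subst (ReachesRoot root p′) (≡.sym (elsewhere v≢y)) (reach _ (rec (rank-parent v≢r))))
    ...   | yes ≡.refl = above v≢r (subst (ReachesRoot root p′) (≡.sym (updateAt-updates v parent))
              (above z≢r (subst (ReachesRoot root p′) (≡.sym (≡.trans (elsewhere z≢y) pz≡py)) (reach _ (rec (rank-parent v≢r))))))

-- Breadth-first spanning trees

module _ {n} (G : Graph n) (conn : Connected G) (root : Fin n) where
  open Graph G

  Within : ℕ → Fin n → Set
  Within zero v = v ≡ root
  Within (suc k) v = ∃ λ u → Adj v u × Within k u

  within? : ∀ k → Decidable (Within k)
  within? zero v = v Fin.≟ root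
  within? (suc k) v = Fin.any? λ u → adj? v u ×-dec within? k u

  Star⇒Within : ∀ {v} → Star Adj v root → ∃ λ k → Within k v
  Star⇒Within Star.ε = 0 , ≡.refl
  Star⇒Within (e ◅ es) with Star⇒Within es
  ... | k , w = suc k , _ , e , w

  distance : ∀ v → ∃ λ m → Within m v × (∀ {j} → Within j v → m ℕ.≤ j)
  distance v with Star⇒Within (conn v root)
  ... | k , w = least (λ m → within? m v) k w

  -- The first step of a shortest walk to the root. One existential covers the root as well, since
  -- its first component is to serve as `parent`.
  closer : ∀ v → ∃ λ u → (v ≡ root → u ≡ root)
    × (v ≢ root → Adj v u × proj₁ (distance u) ℕ.< proj₁ (distance v))
  closer v with v Fin.≟ root | distance v
  ... | yes ≡.refl | _ = root , (λ _ → ≡.refl) , λ r≢r → contradiction ≡.refl r≢r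
  ... | no v≢r | zero , v≡r , _ = contradiction v≡r v≢r
  ... | no v≢r | suc m , (u , vu , w) , _ =
    u , (λ v≡r → contradiction v≡r v≢r) , λ _ → vu , s≤s (proj₂ (proj₂ (distance u)) w)

  -- Turns a given spanning tree into a parent map. It suffices that all its arcs lie in `G`: the
  -- total length is then at most the weight of `G`.
  breadthFirstTree : ∃ λ (P : RootedTree n) → let open RootedTree P in
    ∀ {v} → v ≢ RootedTree.root P → Adj v (parent v)
  breadthFirstTree = record
    { root = root ; parent = λ v → proj₁ (closer v) ; rank = λ v → proj₁ (distance v)
    ; parent-root = proj₁ (proj₂ (closer root)) ≡.refl
    ; rank-parent = λ {v} v≢r → proj₂ (proj₂ (proj₂ (closer v)) v≢r)
    } , λ {v} v≢r → proj₁ (proj₂ (proj₂ (closer v)) v≢r)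

-- Numbering of siblings

lookup-injective : ∀ {A : Set} {xs : List A} → Unique xs → ∀ i j → lookup xs i ≡ lookup xs j → i ≡ j
lookup-injective (_ ∷ _) zero zero _ = ≡.refl
lookup-injective (x∉ ∷ _) zero (suc j) eq = contradiction eq (All.lookup x∉ (∈-lookup j))
lookup-injective (x∉ ∷ _) (suc i) zero eq = contradiction (≡.sym eq) (All.lookup x∉ (∈-lookup i))
lookup-injective (_ ∷ xs!) (suc i) (suc j) eq = ≡.cong suc (lookup-injective xs! i j eq)

-- The vertices with a common parent, root included, are numbered 0, 1, … in
-- the order of increasing key.
module Siblings (O : DecTotalOrder 0ℓ 0ℓ 0ℓ) {n : ℕ} (parent : Fin n → Fin n)
                (key : Fin n → DecTotalOrder.Carrier O) where
  open DecTotalOrder O using (_≤_)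

  abstract
    private
      byKey : DecTotalOrder 0ℓ 0ℓ 0ℓ
      byKey = On.decTotalOrder O key
      open Sort byKey using (sort; sort-↭; sort-↗)

      unsorted children : Fin n → List (Fin n)
      unsorted x = filter (λ y → parent y Fin.≟ x) (allFin n)
      children x = sort (unsorted x)

      ∈-children : ∀ {v x} → parent v ≡ x → v ∈ children x
      ∈-children {v} pv≡x = ∈-resp-↭ (↭-sym (sort-↭ _)) (∈-filter⁺ _ (∈-allFin v) pv≡x)

      parent-child : ∀ {v x} → v ∈ children x → parent v ≡ x
      parent-child v∈ = proj₂ (∈-filter⁻ _ {xs = allFin n} (∈-resp-↭ (sort-↭ _) v∈))

      children! : ∀ x → Unique (children x)
      children! x = Permutationₛ.Unique-resp-↭ (≡.setoid _) (↭⇒↭ₛ (↭-sym (sort-↭ (unsorted x))))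
        (Unique.filter⁺ _ (Unique.allFin⁺ n))

      length-children : ∀ x → length (children x) ℕ.≤ n
      length-children x = subst₂ ℕ._≤_ (≡.sym (↭-length (sort-↭ (unsorted x)))) (length-tabulate _)
        (length-filter _ (allFin n))

      finIndex : ∀ v → Fin (length (children (parent v)))
      finIndex v = index (∈-children {v} ≡.refl)

    idx : Fin n → ℕ
    idx v = toℕ (finIndex v)

    -- x itself is returned when there are at most k children.
    child : Fin n → ℕ → Fin n
    child x k with k ℕ.<? length (children x)
    ... | yes k<l = lookup (children x) (fromℕ< k<l)
    ... | no _ = x

    -- Makes `n` a large enough base for the lexicographic `rank′`.
    idx<n : ∀ v → idx v ℕ.< n
    idx<n v = ℕ.<-≤-trans (Fin.toℕ<n (finIndex v)) (length-children _)

    private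
      child-toℕ : ∀ x i → child x (toℕ i) ≡ lookup (children x) i
      child-toℕ x i with toℕ i ℕ.<? length (children x)
      ... | yes i<l = ≡.cong (lookup (children x)) (Fin.fromℕ<-toℕ i i<l)
      ... | no i≮l = contradiction (Fin.toℕ<n i) i≮l

      idx-lookup : ∀ {x u} i → lookup (children x) i ≡ u → parent u ≡ x → idx u ≡ toℕ i
      idx-lookup {u = u} i i↦u ≡.refl = ≡.cong toℕ (lookup-injective (children! _) (finIndex u) i
        (≡.trans (≡.sym (lookup-index (∈-children {u} ≡.refl))) (≡.sym i↦u)))

      -- An index up to `idx v` is in range, so `child` does not fall back on its default there; the
      -- lemmas that assume `k ≤ idx v` rest on this.
      below : ∀ {v k} → k ℕ.≤ idx v → ∃ λ i → toℕ i ≡ k × child (parent v) k ≡ lookup (children (parent v)) i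
      below {v} {k} k≤ = i , Fin.toℕ-fromℕ< k<l , subst (λ m → child (parent v) m ≡ lookup (children (parent v)) i) (Fin.toℕ-fromℕ< k<l) (child-toℕ _ i)
        where
        k<l : k ℕ.< length (children (parent v))
        k<l = ℕ.≤-<-trans k≤ (Fin.toℕ<n (finIndex v))
        i : Fin (length (children (parent v)))
        i = fromℕ< k<l

    child-idx : ∀ v → child (parent v) (idx v) ≡ v
    child-idx v = ≡.trans (child-toℕ _ (finIndex v)) (≡.sym (lookup-index (∈-children {v} ≡.refl)))

    parent-child-≤ : ∀ {v k} → k ℕ.≤ idx v → parent (child (parent v) k) ≡ parent v
    parent-child-≤ {v} k≤ with below {v} k≤
    ... | i , _ , eq = parent-child (subst (_∈ children (parent v)) (≡.sym eq) (∈-lookup i))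

    idx-child : ∀ {v k} → k ℕ.≤ idx v → idx (child (parent v) k) ≡ k
    idx-child {v} k≤ with below {v} k≤
    ... | i , i≡k , eq = ≡.trans (idx-lookup i (≡.sym eq) (parent-child-≤ {v} k≤)) i≡k

    key-child : ∀ {v k} → k ℕ.≤ idx v → key (child (parent v) k) ≤ key v
    key-child {v} k≤ with below {v} k≤
    ... | i , ≡.refl , eq = subst₂ (λ u w → key u ≤ key w) (≡.sym eq) (≡.sym (lookup-index (∈-children {v} ≡.refl)))
      (Sorted.lookup-mono-≤ (DecTotalOrder.totalOrder byKey) (sort-↗ (unsorted (parent v))) k≤)

-- Minimum spanning trees in a metric space

module _ {n} (P : RootedTree n) where
  open RootedTree P

  -- The orientation agrees with `edges`, which puts the smaller end first. The root yields the loop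
  -- `(root , root)`.
  arc : Fin n → Fin n × Fin n
  arc v with v Fin.<? parent v
  ... | yes _ = v , parent v
  ... | no _ = parent v , v

  mutual-parents : ∀ {u v} → parent u ≡ v → parent v ≡ u → u ≡ v
  mutual-parents {u} {v} pu≡v pv≡u with u Fin.≟ root | v Fin.≟ root
  ... | yes ≡.refl | _ = ≡.trans (≡.sym parent-root) pu≡v
  ... | no _ | yes ≡.refl = ≡.trans (≡.sym pv≡u) parent-root
  ... | no u≢r | no v≢r = contradiction
    (ℕ.<-trans (subst (λ w → rank w ℕ.< rank v) pv≡u (rank-parent v≢r))
               (subst (λ w → rank w ℕ.< rank u) pu≡v (rank-parent u≢r))) (ℕ.<-irrefl ≡.refl)

  arc-injective : ∀ {u v} → arc u ≡ arc v → u ≡ v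
  arc-injective {u} {v} eq with u Fin.<? parent u | v Fin.<? parent v
  ... | yes _ | yes _ = ≡.cong proj₁ eq
  ... | no _ | no _ = ≡.cong proj₂ eq
  ... | yes _ | no _ = mutual-parents (≡.cong proj₂ eq) (≡.sym (≡.cong proj₁ eq))
  ... | no _ | yes _ = mutual-parents (≡.cong proj₁ eq) (≡.sym (≡.cong proj₂ eq))

  edges⊆arcs : edges graph ⊆ map arc (allFin n)
  edges⊆arcs {u , v} e with proj₂ (∈-filter⁻ _ {xs = cartesianProduct (allFin n) (allFin n)} e)
  ... | u<v , _ , inj₁ ≡.refl = subst (_∈ _) arc≡ (∈-map⁺ arc (∈-allFin u))
    where
    arc≡ : arc u ≡ (u , parent u)
    arc≡ with u Fin.<? parent u
    ... | yes _ = ≡.refl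
    ... | no u≮pu = contradiction u<v u≮pu
  ... | u<v , _ , inj₂ ≡.refl = subst (_∈ _) arc≡ (∈-map⁺ arc (∈-allFin v))
    where
    arc≡ : arc v ≡ (parent v , v)
    arc≡ with v Fin.<? parent v
    ... | yes v<pv = contradiction u<v (ℕ.<-asym v<pv)
    ... | no _ = ≡.refl

  -- The additional pair accommodates the loop at the root, which has length 0.
  arcs⊆edges : ∀ {G : Graph n} → (∀ {v} → v ≢ root → Graph.Adj G v (parent v)) →
    map arc (allFin n) ⊆ (root , root) ∷ edges G
  arcs⊆edges {G} adj e with ∈-map⁻ arc e
  ... | v , _ , ≡.refl = arc∈ v
    where
    edge : ∀ {u v} → u Fin.< v → Graph.Adj G u v → (u , v) ∈ (root , root) ∷ edges G
    edge u<v uv = there (∈-filter⁺ _ (∈-cartesianProduct⁺ (∈-allFin _) (∈-allFin _)) (u<v , uv))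
    arc∈ : ∀ v → arc v ∈ (root , root) ∷ edges G
    arc∈ v with v Fin.≟ root | v Fin.<? parent v
    ... | yes ≡.refl | yes _ = here (≡.cong (root ,_) parent-root)
    ... | yes ≡.refl | no _ = here (≡.cong (_, root) parent-root)
    ... | no v≢r | yes v<pv = edge v<pv (adj v≢r)
    ... | no v≢r | no v≮pv = edge (Fin.≤∧≢⇒< (ℕ.≮⇒≥ v≮pv) (v≢r ∘ fixed⇒root)) (Graph.sym G (adj v≢r))

module MetricTrees {ℝ : Reals} {n : ℕ} (X : FiniteMetricSpace ℝ n) where
  open Exponential ℝ
  open FiniteMetricSpace X public
  open IsGeneralMetric isMetric public using (triangle) renaming (nonNegative to d≥0; sym to d-sym; 0⇒≈ to d≈0⇒≡; ≈⇒0 to ≡⇒d≈0)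
  open Sum semiring public using (sum; sum-remove; sum-cong-≋; *-distribˡ-sum)
  open ≤-Reasoning

  d-refl : ∀ x → d x x ≈ 0#
  d-refl x = ≡⇒d≈0 ≡.refl

  sumList : ∀ {A : Set} → (A → Carrier) → List A → Carrier
  sumList f xs = foldr _+_ 0# (map f xs)

  sumList-↭ : ∀ {A : Set} (f : A → Carrier) {xs ys} → xs ↭ ys → sumList f xs ≈ sumList f ys
  sumList-↭ f Perm.refl = refl
  sumList-↭ f (Perm.prep x ρ) = +-congˡ (sumList-↭ f ρ)
  sumList-↭ f (Perm.swap x y ρ) = trans (+-congˡ (+-congˡ (sumList-↭ f ρ)))
    (solve 3 (λ a b c → a :+ (b :+ c) := b :+ (a :+ c)) refl _ _ _)
  sumList-↭ f (Perm.trans ρ σ) = trans (sumList-↭ f ρ) (sumList-↭ f σ)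

  0≤sumList : ∀ {A : Set} (f : A → Carrier) → (∀ x → 0# ≤ f x) → ∀ xs → 0# ≤ sumList f xs
  0≤sumList f f≥0 [] = ≤-refl
  0≤sumList f f≥0 (x ∷ xs) = +-nonNegative (f≥0 x) (0≤sumList f f≥0 xs)

  sumList-⊆ : ∀ {A : Set} (f : A → Carrier) → (∀ x → 0# ≤ f x) →
    ∀ {xs ys} → Unique xs → xs ⊆ ys → sumList f xs ≤ sumList f ys
  sumList-⊆ f f≥0 {xs} {ys} xs! xs⊆ys with Unique∧⊆⇒↭ xs! xs⊆ys
  ... | zs , ρ = begin
    sumList f xs         ≤⟨ prefix xs ⟩
    sumList f (xs ++ zs) ≈⟨ sumList-↭ f ρ ⟨
    sumList f ys         ∎
    where
    prefix : ∀ xs → sumList f xs ≤ sumList f (xs ++ zs)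
    prefix [] = 0≤sumList f f≥0 zs
    prefix (x ∷ xs) = +-monoʳ-≤ _ (prefix xs)

  sumList-tabulate : ∀ {A : Set} {m} (f : A → Carrier) (t : Fin m → A) → sumList f (tabulate t) ≡ sum (f ∘ t)
  sumList-tabulate {m = zero} f t = ≡.refl
  sumList-tabulate {m = suc m} f t = ≡.cong (f (t zero) +_) (sumList-tabulate f (t ∘ suc))

  sum-mono : ∀ {m} {f g : Vector Carrier m} → (∀ i → f i ≤ g i) → sum f ≤ sum g
  sum-mono {zero} f≤g = ≤-refl
  sum-mono {suc m} f≤g = +-mono-≤ (f≤g zero) (sum-mono (f≤g ∘ suc))

  -- Isolates the only vertex whose parent changes in an exchange.
  sum-cancel-≤ : ∀ {m} {f g : Vector Carrier m} i → (∀ j → j ≢ i → f j ≈ g j) → sum f ≤ sum g → f i ≤ g i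
  sum-cancel-≤ {suc m} {f} {g} i f≈g Σf≤Σg = +-cancelʳ-≤ (sum (removeAt f i)) (begin
    f i + sum (removeAt f i) ≈⟨ sum-remove {i = i} f ⟨
    sum f                    ≤⟨ Σf≤Σg ⟩
    sum g                    ≈⟨ sum-remove {i = i} g ⟩
    g i + sum (removeAt g i) ≈⟨ +-congˡ (sum-cong-≋ λ j → f≈g _ (Fin.punchInᵢ≢i i j)) ⟨
    g i + sum (removeAt f i) ∎)

  toParent : (Fin n → Fin n) → Fin n → Carrier
  toParent p v = d v (p v)

  totalToParent : RootedTree n → Carrier
  totalToParent P = sum (toParent (RootedTree.parent P))

  private
    edgeLength : Fin n × Fin n → Carrier
    edgeLength = uncurry d

    sum-arcs : ∀ P → sumList edgeLength (map (arc P) (allFin n)) ≈ totalToParent P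
    sum-arcs P = begin-equality
      sumList edgeLength (map (arc P) (allFin n)) ≡⟨ ≡.cong (sumList edgeLength) (map-tabulate (λ v → v) (arc P)) ⟩
      sumList edgeLength (tabulate (arc P))       ≡⟨ sumList-tabulate edgeLength (arc P) ⟩
      sum (edgeLength ∘ arc P)                    ≈⟨ sum-cong-≋ arc-length ⟩
      totalToParent P                          ∎
      where
      open RootedTree P
      arc-length : ∀ v → edgeLength (arc P v) ≈ d v (parent v)
      arc-length v with v Fin.<? parent v
      ... | yes _ = refl
      ... | no _ = d-sym _ _

  weight-graph-≤ : ∀ P → weight X (RootedTree.graph P) ≤ totalToParent P
  weight-graph-≤ P = begin
    sumList edgeLength (edges (RootedTree.graph P))
      ≤⟨ sumList-⊆ edgeLength (λ _ → d≥0) (Unique.filter⁺ _ (Unique.cartesianProduct⁺ (Unique.allFin⁺ n) (Unique.allFin⁺ n))) (edges⊆arcs P) ⟩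
    sumList edgeLength (map (arc P) (allFin n)) ≈⟨ sum-arcs P ⟩
    totalToParent P ∎

  ≤weight : ∀ {G} P → (∀ {v} → v ≢ RootedTree.root P → Graph.Adj G v (RootedTree.parent P v)) →
    totalToParent P ≤ weight X G
  ≤weight {G} P adj = begin
    totalToParent P                          ≈⟨ sum-arcs P ⟨
    sumList edgeLength (map (arc P) (allFin n))
      ≤⟨ sumList-⊆ edgeLength (λ _ → d≥0) (Unique.map⁺ (arc-injective P) (Unique.allFin⁺ n)) (arcs⊆edges P {G} adj) ⟩
    d root root + weight X G                 ≈⟨ +-congʳ (d-refl root) ⟩
    0# + weight X G                          ≈⟨ +-identityˡ _ ⟩
    weight X G                               ∎
    where open RootedTree P

  -- Minimality is restated for `totalToParent` among parent maps, where an exchange alters a single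
  -- summand.
  IsMinimal : RootedTree n → Set
  IsMinimal P = ∀ P′ → totalToParent P ≤ totalToParent P′

  minimalTree : ∀ {m} → Fin n → IsMSTWeight X m → ∃ λ P → totalToParent P ≤ m × IsMinimal P
  minimalTree {m} r ((T , (conn , _) , wT≈m) , m≤) with breadthFirstTree T conn r
  ... | P , P⊆T = P , P≤m , λ P′ → ≤-trans P≤m
      (≤-trans (m≤ (RootedTree.graph P′) (RootedTree.isSpanningTree P′)) (weight-graph-≤ P′))
    where
    P≤m : totalToParent P ≤ m
    P≤m = ≤-trans (≤weight {T} P P⊆T) (≤-reflexive wT≈m)

  -- Otherwise attaching u to v instead of its parent would give a lighter tree.
  siblings-apart : ∀ {P} → IsMinimal P → let open RootedTree P in
    ∀ {u v} → u ≢ v → parent u ≡ parent v → d u (parent u) ≤ d u v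
  siblings-apart {P} min {u} {v} u≢v pu≡pv with u Fin.≟ RootedTree.root P | v Fin.≟ RootedTree.root P
  ... | yes ≡.refl | _ = ≤-trans (≤-reflexive (≡⇒d≈0 (≡.sym parent-root))) d≥0
    where open RootedTree P
  ... | no _ | yes ≡.refl = ≤-reflexive (reflexive (≡.cong (d u) (≡.trans pu≡pv parent-root)))
    where open RootedTree P
  ... | no u≢r | no v≢r with reattachTree P u≢r v≢r (≢-sym u≢v) (≡.sym pu≡pv)
  ...   | P′ , ≡.refl = subst (λ w → d u (parent u) ≤ d u w) (updateAt-updates u parent)
          (sum-cancel-≤ u (λ j j≢u → reflexive (≡.cong (d j) (≡.sym (updateAt-minimal j u parent j≢u)))) (min P′))
    where open RootedTree P

  CoversWithin : ℕ → Set
  CoversWithin N = ∀ x r → ∃ λ cs → length cs ℕ.≤ N × HalfRadiusCover X x r cs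

  -- Each ball of a cover is covered once more, hence the product.
  quarterCover : ∀ {N} → CoversWithin N → ∀ x r → ∃ λ cs → length cs ℕ.≤ N ℕ.* N
    × (∀ {y} → d x y ≤ r → Any (λ c → d c y ≤ r * ½ * ½) cs)
  quarterCover {N} covers x r with covers x r
  ... | cs , |cs|≤N , cover = concatMap centers cs
    , ℕ.≤-trans (length-concatMap cs) (ℕ.*-monoˡ-≤ N |cs|≤N)
    , λ y∈ → concatMap⁺ centers (Any.map (λ {c} y∈c → proj₂ (proj₂ (covers c (r * ½))) y∈c) (cover y∈))
    where
    centers : Fin n → List (Fin n)
    centers c = proj₁ (covers c (r * ½))
    length-concatMap : ∀ cs → length (concatMap centers cs) ℕ.≤ length cs ℕ.* N
    length-concatMap [] = z≤n
    length-concatMap (c ∷ cs) = subst (ℕ._≤ N ℕ.+ length cs ℕ.* N) (≡.sym (length-++ (centers c)))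
      (ℕ.+-mono-≤ (proj₁ (proj₂ (covers c (r * ½)))) (length-concatMap cs))

  -- Points of a ball that are pairwise more than half its radius apart lie
  -- in different balls of a quarter of the radius.
  packing : ∀ {N} → CoversWithin N → ∀ x r (p : Fin (suc (N ℕ.* N)) → Fin n) →
    (∀ i → d x (p i) ≤ r) → ∃ λ i → ∃ λ j → i ≢ j × d (p i) (p j) ≤ r * ½
  packing {N} covers x r p p∈ with quarterCover covers x r
  ... | cs , |cs|≤N² , cover with Fin.pigeonhole (s≤s |cs|≤N²) (λ i → index (cover (p∈ i)))
  ...   | i , j , i<j , same = i , j , Fin.<⇒≢ i<j , (begin
    d (p i) (p j)                ≤⟨ triangle _ c _ ⟩
    d (p i) c + d c (p j)        ≈⟨ +-congʳ (d-sym _ _) ⟩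
    d c (p i) + d c (p j)        ≤⟨ +-mono-≤ (lookup-index (cover (p∈ i)))
                                      (subst (λ k → d (lookup cs k) (p j) ≤ r * ½ * ½) (≡.sym same) (lookup-index (cover (p∈ j)))) ⟩
    r * ½ * ½ + r * ½ * ½        ≈⟨ x½+x½ _ ⟩
    r * ½                        ∎)
    where
    c : Fin n
    c = lookup cs (index (cover (p∈ i)))

-- Relinking the siblings

module Relinking {ℝ : Reals} {n : ℕ} (X : FiniteMetricSpace ℝ n) {N : ℕ} (covers : MetricTrees.CoversWithin X N)
                 (P : RootedTree n) (min : MetricTrees.IsMinimal X P) where
  open MetricTrees X
  open Exponential ℝ
  open ≤-Reasoning
  open RootedTree P
  open Siblings decTotalOrder parent (toParent parent)

  δ : Fin n → Carrier
  δ = toParent parent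

  -- The N² + 1 consecutive siblings ending at `v` lie within `δ v` of the parent, so two of them
  -- are at most `δ v * ½` apart. By `siblings-apart` one of these is equally near the parent, and
  -- the first of the row is no farther.
  halving : ∀ {v} → N ℕ.* N ℕ.≤ idx v → δ (child (parent v) (idx v ℕ.∸ N ℕ.* N)) ≤ δ v * ½
  halving {v} N²≤ = begin
      δ (child (parent v) base)        ≡⟨ ≡.cong (λ x → δ (child x base)) (parent-p i) ⟨
      δ (child (parent (p i)) base)    ≤⟨ key-child {p i} (subst (base ℕ.≤_) (≡.sym (idx-p i)) (ℕ.m≤m+n base _)) ⟩
      δ (p i)                          ≤⟨ siblings-apart {P} min pi≢pj (≡.trans (parent-p i) (≡.sym (parent-p j))) ⟩
      d (p i) (p j)                    ≤⟨ proj₂ (proj₂ (proj₂ close)) ⟩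
      δ v * ½                          ∎
    where
    base : ℕ
    base = idx v ℕ.∸ N ℕ.* N
    p : Fin (suc (N ℕ.* N)) → Fin n
    p i = child (parent v) (base ℕ.+ toℕ i)
    i≤ : ∀ i → base ℕ.+ toℕ i ℕ.≤ idx v
    i≤ i = subst (base ℕ.+ toℕ i ℕ.≤_) (ℕ.m∸n+n≡m N²≤) (ℕ.+-monoʳ-≤ base (Fin.toℕ≤pred[n] i))
    parent-p : ∀ i → parent (p i) ≡ parent v
    parent-p i = parent-child-≤ {v} (i≤ i)
    idx-p : ∀ i → idx (p i) ≡ base ℕ.+ toℕ i
    idx-p i = idx-child {v} (i≤ i)
    p∈ : ∀ i → d (parent v) (p i) ≤ δ v
    p∈ i = begin
      d (parent v) (p i)       ≈⟨ d-sym _ _ ⟩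
      d (p i) (parent v)       ≡⟨ ≡.cong (d (p i)) (parent-p i) ⟨
      δ (p i)                  ≤⟨ key-child {v} (i≤ i) ⟩
      δ v                      ∎
    close : ∃ λ i → ∃ λ j → i ≢ j × d (p i) (p j) ≤ δ v * ½
    close = packing covers (parent v) (δ v) p p∈
    i j : Fin (suc (N ℕ.* N))
    i = proj₁ close
    j = proj₁ (proj₂ close)
    pi≢pj : p i ≢ p j
    pi≢pj eq = proj₁ (proj₂ (proj₂ close))
      (Fin.toℕ-injective (ℕ.+-cancelˡ-≡ base _ _ (≡.trans (≡.sym (idx-p i)) (≡.trans (≡.cong idx eq) (idx-p j)))))

  decay : ∀ k {v} → k ℕ.* (N ℕ.* N) ℕ.≤ idx v →
    δ (child (parent v) (idx v ℕ.∸ k ℕ.* (N ℕ.* N))) ≤ δ v * ½ ^ k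
  decay zero {v} _ = begin
    δ (child (parent v) (idx v)) ≡⟨ ≡.cong δ (child-idx v) ⟩
    δ v                          ≈⟨ *-identityʳ _ ⟨
    δ v * 1#                     ∎
  decay (suc k) {v} sk≤ = begin
    δ (child (parent v) (idx v ℕ.∸ (N² ℕ.+ k ℕ.* N²)))   ≡⟨ ≡.cong δ (≡.cong₂ child parent-u idx-u) ⟨
    δ (child (parent u) (idx u ℕ.∸ k ℕ.* N²))            ≤⟨ decay k kN²≤ ⟩
    δ u * ½ ^ k                                          ≤⟨ *-monoˡ-≤ (0≤^ k 0≤½) (halving N²≤) ⟩
    δ v * ½ * ½ ^ k                                      ≈⟨ *-assoc _ _ _ ⟩
    δ v * ½ ^ suc k                                      ∎
    where
    N² : ℕ
    N² = N ℕ.* N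
    N²≤ : N² ℕ.≤ idx v
    N²≤ = ℕ.m+n≤o⇒m≤o N² sk≤
    u : Fin n
    u = child (parent v) (idx v ℕ.∸ N²)
    parent-u : parent u ≡ parent v
    parent-u = parent-child-≤ {v} (ℕ.m∸n≤m _ N²)
    idx-u′ : idx u ≡ idx v ℕ.∸ N²
    idx-u′ = idx-child {v} (ℕ.m∸n≤m _ N²)
    idx-u : idx u ℕ.∸ k ℕ.* N² ≡ idx v ℕ.∸ (N² ℕ.+ k ℕ.* N²)
    idx-u = ≡.trans (≡.cong (ℕ._∸ k ℕ.* N²) idx-u′) (ℕ.∸-+-assoc (idx v) N² _)
    kN²≤ : k ℕ.* N² ℕ.≤ idx u
    kN²≤ = subst (k ℕ.* N² ℕ.≤_) (≡.sym idx-u′) (ℕ.m+n≤o⇒m≤o∸n (k ℕ.* N²) (subst (ℕ._≤ idx v) (ℕ.+-comm N² _) sk≤))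

  -- `M` counts halvings. With `D` equal to 0 every vertex would become its own parent; `0<D`
  -- excludes this.
  module _ (M : ℕ) (0<D : 0 ℕ.< M ℕ.* (N ℕ.* N)) where

    D : ℕ
    D = M ℕ.* (N ℕ.* N)

    relinked : Fin n → Fin n
    relinked v with D ℕ.≤? idx v
    ... | yes _ = child (parent v) (idx v ℕ.∸ D)
    ... | no _ = parent v

    -- The root is its own child at distance 0, so the first child is at distance 0 too; it then
    -- equals its parent and is the root. Having index 0, the root is not relinked.
    child-root : child root 0 ≡ root × idx root ≡ 0
    child-root = u≡root , ≡.trans (≡.cong idx (≡.sym u≡root)) (subst (λ x → idx (child x 0) ≡ 0) parent-root (idx-child {root} z≤n))
      where
      u : Fin n
      u = child root 0
      δu≤0 : δ u ≤ 0#
      δu≤0 = begin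
        δ (child root 0)          ≡⟨ ≡.cong (λ x → δ (child x 0)) parent-root ⟨
        δ (child (parent root) 0) ≤⟨ key-child {root} z≤n ⟩
        δ root                    ≈⟨ ≡⇒d≈0 (≡.sym parent-root) ⟩
        0#                        ∎
      u≡root : u ≡ root
      u≡root = fixed⇒root (≡.sym (d≈0⇒≡ (≤-antisym δu≤0 d≥0)))

    -- Lexicographic in the old parent's rank and the index; siblings share the former.
    rank′ : Fin n → ℕ
    rank′ v = rank (parent v) ℕ.* n ℕ.+ idx v

    0<idx : ∀ {v} → parent v ≡ root → v ≢ root → 0 ℕ.< idx v
    0<idx {v} pv≡r v≢r = ℕ.n≢0⇒n>0 λ idx≡0 → v≢r
      (≡.trans (≡.sym (child-idx v)) (≡.trans (≡.cong₂ child pv≡r idx≡0) (proj₁ child-root)))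

    -- The rank of the old parent does not drop when `v` is a child of the root, since the root's
    -- parent is again the root. In that case the index decides: the root has index 0 and `v` a
    -- positive one.
    rank′-parent : ∀ {v} → v ≢ root → rank′ (parent v) ℕ.< rank′ v
    rank′-parent {v} v≢r with parent v Fin.≟ root
    ... | yes pv≡r = ℕ.+-mono-≤-<
          (ℕ.≤-reflexive (≡.cong (λ x → rank x ℕ.* n) (≡.trans (≡.cong parent pv≡r) (≡.trans parent-root (≡.sym pv≡r)))))
          (subst (ℕ._< idx v) (≡.sym (≡.trans (≡.cong idx pv≡r) (proj₂ child-root))) (0<idx pv≡r v≢r))
    ... | no pv≢r = ℕ.<-≤-trans (ℕ.+-monoʳ-< (rank (parent (parent v)) ℕ.* n) (idx<n (parent v)))
          (ℕ.≤-trans (ℕ.≤-trans (ℕ.≤-reflexive (ℕ.+-comm _ n)) (ℕ.*-monoˡ-≤ n (rank-parent pv≢r))) (ℕ.m≤m+n _ (idx v)))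

    relinkedTree : RootedTree n
    relinkedTree = record
      { root = root ; parent = relinked ; rank = rank′
      ; parent-root = relinked-root ; rank-parent = decreasing
      }
      where
      relinked-root : relinked root ≡ root
      relinked-root with D ℕ.≤? idx root
      ... | yes D≤0 = contradiction (subst (D ℕ.≤_) (proj₂ child-root) D≤0) (ℕ.<⇒≱ 0<D)
      ... | no _ = parent-root
      decreasing : ∀ {v} → v ≢ root → rank′ (relinked v) ℕ.< rank′ v
      decreasing {v} v≢r with D ℕ.≤? idx v
      ... | no _ = rank′-parent v≢r
      ... | yes D≤ = subst₂ (λ x i → rank x ℕ.* n ℕ.+ i ℕ.< rank′ v)
            (≡.sym (parent-child-≤ {v} (ℕ.m∸n≤m _ D))) (≡.sym (idx-child {v} (ℕ.m∸n≤m _ D)))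
            (ℕ.+-monoʳ-< _ (ℕ.∸-monoʳ-< 0<D D≤))

    toRelinked : ∀ v → d v (relinked v) ≤ (1# + ½ ^ M) * δ v
    toRelinked v with D ℕ.≤? idx v
    ... | no _ = begin
      δ v                       ≤⟨ x≤x+y (*-nonNegative (0≤^ M 0≤½) d≥0) ⟩
      δ v + ½ ^ M * δ v         ≈⟨ +-congʳ (*-identityˡ _) ⟨
      1# * δ v + ½ ^ M * δ v    ≈⟨ distribʳ _ _ _ ⟨
      (1# + ½ ^ M) * δ v        ∎
    ... | yes D≤ = begin
      d v u                     ≤⟨ triangle v (parent v) u ⟩
      δ v + d (parent v) u      ≈⟨ +-congˡ (d-sym _ _) ⟩
      δ v + d u (parent v)      ≡⟨ ≡.cong (λ x → δ v + d u x) (parent-child-≤ {v} (ℕ.m∸n≤m _ D)) ⟨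
      δ v + δ u                 ≤⟨ +-monoʳ-≤ _ (decay M D≤) ⟩
      δ v + δ v * ½ ^ M         ≈⟨ +-cong (sym (*-identityˡ _)) (*-comm _ _) ⟩
      1# * δ v + ½ ^ M * δ v    ≈⟨ distribʳ _ _ _ ⟨
      (1# + ½ ^ M) * δ v        ∎
      where
      u : Fin n
      u = child (parent v) (idx v ℕ.∸ D)

    relinked-weight : totalToParent relinkedTree ≤ (1# + ½ ^ M) * totalToParent P
    relinked-weight = ≤-trans (sum-mono toRelinked) (≤-reflexive (sym (*-distribˡ-sum (1# + ½ ^ M) δ)))

    relinked-degree : ∀ x → degree (RootedTree.graph relinkedTree) x ℕ.≤ 2 ℕ.+ D
    relinked-degree x = subst (degree graph′ x ℕ.≤_) (≡.cong (2 ℕ.+_) (length-applyUpTo (child x) D))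
      (Unique∧⊆⇒length≤ (Unique.filter⁺ (adj? x) (Unique.allFin⁺ n)) neighbours)
      where
      graph′ : Graph n
      graph′ = RootedTree.graph relinkedTree
      open Graph graph′ using (adj?)
      -- If no sibling comes `D` places after `x`, the second entry is the default of `child`; this
      -- is harmless in a list that only has to contain the neighbours.
      neighbours : filter (adj? x) (allFin n) ⊆ relinked x ∷ child (parent x) (idx x ℕ.+ D) ∷ applyUpTo (child x) D
      neighbours {y} y∈ with proj₂ (proj₂ (∈-filter⁻ (adj? x) {xs = allFin n} y∈))
      ... | inj₁ ≡.refl = here ≡.refl
      ... | inj₂ rel≡x with D ℕ.≤? idx y
      ...   | yes D≤ = there (here (≡.sym (≡.trans (≡.cong₂ child (parents rel≡x) (indices rel≡x)) (child-idx y))))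
        where
        u = child (parent y) (idx y ℕ.∸ D)
        parents : u ≡ x → parent x ≡ parent y
        parents ≡.refl = parent-child-≤ {y} (ℕ.m∸n≤m _ D)
        indices : u ≡ x → idx x ℕ.+ D ≡ idx y
        indices ≡.refl = ≡.trans (≡.cong (ℕ._+ D) (idx-child {y} (ℕ.m∸n≤m _ D))) (ℕ.m∸n+n≡m D≤)
      ...   | no D≰ = there (there (subst (_∈ _) (child-idx y)
                        (subst (λ p → child p (idx y) ∈ applyUpTo (child x) D) (≡.sym rel≡x) (∈-applyUpTo⁺ (child x) (ℕ.≰⇒> D≰)))))

-- Trivial spaces, and the lower bound 2 on the doubling constant

maxDegree≤ : ∀ {n} (G : Graph n) {D} → (∀ x → degree G x ℕ.≤ D) → maxDegree G ℕ.≤ D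
maxDegree≤ {n} G deg≤ = Extremaℕ.max≤v⁺ z≤n (All.map⁺ (All.universal deg≤ (allFin n)))

degree-subsingleton : ∀ {n} (G : Graph n) → (∀ (x y : Fin n) → x ≡ y) → ∀ x → degree G x ℕ.≤ 0
degree-subsingleton {n} G x≡y x = ℕ.≤-reflexive (≡.cong length
  (filter-none (Graph.adj? G x) (All.universal (λ y → Graph.irrefl G (x≡y x y)) (allFin n))))

module _ {ℝ : Reals} {m : ℕ} (X : FiniteMetricSpace ℝ (suc (suc m))) where
  open Exponential ℝ
  open MetricTrees X
  open ≤-Reasoning

  private
    V : Set
    V = Fin (suc (suc m))
    distinct? = λ ((u , v) : V × V) → ¬? (u Fin.≟ v)

  closestPair : ∃ λ u → ∃ λ v → u ≢ v × (∀ {x y} → x ≢ y → d u v ≤ d x y)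
  closestPair = proj₁ pair , proj₂ pair , argmin-all (uncurry d) (λ ()) (All.tabulate (proj₂ ∘ ∈-filter⁻ distinct? {xs = allPairs})) ,
    λ x≢y → All.lookup (f[argmin]≤f[xs] {f = uncurry d} (Fin.zero , suc Fin.zero) pairs)
      (∈-filter⁺ distinct? (∈-cartesianProduct⁺ (∈-allFin _) (∈-allFin _)) x≢y)
    where
    open Extrema totalOrder
    allPairs pairs : List (V × V)
    allPairs = cartesianProduct (allFin _) (allFin _)
    pairs = filter distinct? allPairs
    pair : V × V
    -- The starting value is itself a pair of distinct points, so the minimum is attained at
    -- distinct points; this is where the space must have two.
    pair = argmin (uncurry d) (Fin.zero , suc Fin.zero) pairs

  -- A ball whose radius is half the least distance contains only its centre, so `u` and `v` must
  -- both be centres.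
  closestPair-cover : ∀ {u v} → u ≢ v → (∀ {x y} → x ≢ y → d u v ≤ d x y) →
    ∀ cs → HalfRadiusCover X u (d u v) cs → 2 ℕ.≤ length cs
  closestPair-cover {u} {v} u≢v closest cs cover = Unique∧⊆⇒length≤ ((u≢v ∷ []) ∷ [] ∷ []) uv⊆cs
    where
    near⇒≡ : ∀ {c y} → d c y ≤ d u v * ½ → c ≡ y
    near⇒≡ {c} {y} near = decidable-stable (c Fin.≟ y) λ c≢y →
      <⇒≱ (x½<x (d≥0 , u≢v ∘ d≈0⇒≡ ∘ sym)) (≤-trans (closest c≢y) near)
    centre : ∀ {y} → d u y ≤ d u v → y ∈ cs
    centre y∈ = let c , c∈cs , near = find (cover y∈) in subst (_∈ cs) (near⇒≡ near) c∈cs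
    uv⊆cs : ∀ {y} → y ∈ u ∷ v ∷ [] → y ∈ cs
    uv⊆cs (here ≡.refl) = centre (≤-trans (≤-reflexive (d-refl u)) d≥0)
    uv⊆cs (there (here ≡.refl)) = centre ≤-refl

  2≤exp₂ : ∀ {t} → (∀ x r → ∃ λ cs → fromℕ (length cs) ≤ exp₂ t × HalfRadiusCover X x r cs) → 2# ≤ exp₂ t
  2≤exp₂ {t} covers =
    let u , v , u≢v , closest = closestPair
        cs , |cs|≤L , cover = covers u (d u v)
    in begin
    2#                   ≈⟨ +-congˡ fromℕ-1 ⟨
    fromℕ 2              ≤⟨ fromℕ-mono-≤ (closestPair-cover u≢v closest cs cover) ⟩
    fromℕ (length cs)    ≤⟨ |cs|≤L ⟩
    exp₂ t               ∎

-- Dyadic scales and the arithmetic of the degree bound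

module Bounds (ℝ : Reals) where
  open Exponential ℝ
  open ≤-Reasoning
  open Max totalOrder using (x≤x⊔y; x≤y⊔x)

  ½^*2^ : ∀ k → 2# ^ k * ½ ^ k ≈ 1#
  ½^*2^ zero = *-identityˡ 1#
  ½^*2^ (suc k) = begin-equality
    2# * 2# ^ k * (½ * ½ ^ k)    ≈⟨ solve 4 (λ a b c d → a :* b :* (c :* d) := (a :* c) :* (b :* d)) refl 2# (2# ^ k) ½ (½ ^ k) ⟩
    2# * ½ * (2# ^ k * ½ ^ k)    ≈⟨ *-cong 2*½ (½^*2^ k) ⟩
    1# * 1#                      ≈⟨ *-identityˡ 1# ⟩
    1#                           ∎

  -- Here `k` is the integer part of log(1/ε). Both 1 and `k` are at most the maximum with 1, so
  -- rounding up costs only a factor 2.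
  dyadicScale : ∀ {ε} → 0# < ε → ε < 1# → ∃ λ k → ½ ^ suc k ≤ ε × fromℕ (suc k) ≤ 2# * (1# ⊔ log₂ (ε ⁻¹))
  dyadicScale {ε} 0<ε ε<1 = k , ½^≤ε , (begin
    1# + fromℕ k                          ≤⟨ +-mono-≤ (x≤x⊔y 1# _) (≤-trans (≤log₂ k (proj₁ (proj₂ power))) (x≤y⊔x 1# _)) ⟩
    W + W                                 ≈⟨ +-cong (*-identityˡ W) (*-identityˡ W) ⟨
    1# * W + 1# * W                       ≈⟨ distribʳ W 1# 1# ⟨
    2# * W                                ∎)
    where
    W : Carrier
    W = 1# ⊔ log₂ (ε ⁻¹)
    εε⁻¹ : ε * ε ⁻¹ ≈ 1#
    εε⁻¹ = ⁻¹-inverseʳ ε (>⇒≉ 0<ε)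
    1≤ε⁻¹ : 1# ≤ ε ⁻¹
    1≤ε⁻¹ = *-cancelˡ-≤ 0<ε (begin
      ε * 1#     ≈⟨ *-identityʳ ε ⟩
      ε          ≤⟨ <⇒≤ ε<1 ⟩
      1#         ≈⟨ εε⁻¹ ⟨
      ε * ε ⁻¹   ∎)
    power : ∃ λ k → 2# ^ k ≤ ε ⁻¹ × ε ⁻¹ < 2# ^ suc k
    power = dyadicFloor (ε ⁻¹) 1≤ε⁻¹
    k : ℕ
    k = proj₁ power
    ½^≤ε : ½ ^ suc k ≤ ε
    ½^≤ε = *-cancelˡ-≤ (0<^ (suc k) 0<2) (begin
      2# ^ suc k * ½ ^ suc k    ≈⟨ ½^*2^ (suc k) ⟩
      1#                        ≈⟨ εε⁻¹ ⟨
      ε * ε ⁻¹                  ≤⟨ *-monoʳ-≤ (<⇒≤ 0<ε) (<⇒≤ (proj₂ (proj₂ power))) ⟩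
      ε * 2# ^ suc k            ≈⟨ *-comm _ _ ⟩
      2# ^ suc k * ε            ∎)

  -- The additive 2 is at most M N², and the resulting factor 2 is at most `N`.
  2+MN²≤ : ∀ {M N} → 1 ℕ.≤ M → 2 ℕ.≤ N → 2 ℕ.+ M ℕ.* (N ℕ.* N) ℕ.≤ M ℕ.* (N ℕ.* (N ℕ.* N))
  2+MN²≤ {M} {N} 1≤M 2≤N = ℕR.begin
    2 ℕ.+ M ℕ.* (N ℕ.* N)                       ℕR.≤⟨ ℕ.+-monoˡ-≤ _ (ℕ.*-mono-≤ 1≤M (ℕ.*-mono-≤ 2≤N (ℕ.<⇒≤ 2≤N))) ⟩
    M ℕ.* (N ℕ.* N) ℕ.+ M ℕ.* (N ℕ.* N)         ℕR.≡⟨ ℕ.*-distribˡ-+ M (N ℕ.* N) (N ℕ.* N) ⟨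
    M ℕ.* (N ℕ.* N ℕ.+ N ℕ.* N)                 ℕR.≡⟨ ≡.cong (λ e → M ℕ.* (N ℕ.* N ℕ.+ e)) (ℕ.+-identityʳ (N ℕ.* N)) ⟨
    M ℕ.* (2 ℕ.* (N ℕ.* N))                     ℕR.≤⟨ ℕ.*-monoʳ-≤ M (ℕ.*-monoˡ-≤ (N ℕ.* N) 2≤N) ⟩
    M ℕ.* (N ℕ.* (N ℕ.* N))                     ℕR.∎
    where module ℕR = ℕ.≤-Reasoning

  -- With z = y², the hypotheses give M ≤ z W and N ≤ z², whence M N³ ≤ z⁷ W.
  degreeBound : ∀ {y L W M N} → 2# ≤ L → L ≤ y ^ 2 → 0# ≤ W → 1 ℕ.≤ M → 2 ℕ.≤ N →
    fromℕ M ≤ 2# * W → fromℕ N ≤ 2# * L → fromℕ (2 ℕ.+ M ℕ.* (N ℕ.* N)) ≤ y ^ 14 * W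
  degreeBound {y} {L} {W} {M} {N} 2≤L L≤y² 0≤W 1≤M 2≤N M≤2W N≤2L = begin
    fromℕ (2 ℕ.+ M ℕ.* (N ℕ.* N))             ≤⟨ fromℕ-mono-≤ (2+MN²≤ 1≤M 2≤N) ⟩
    fromℕ (M ℕ.* (N ℕ.* (N ℕ.* N)))           ≈⟨ trans (×1-homo-* M _) (*-congˡ (trans (×1-homo-* N _) (*-congˡ (×1-homo-* N N)))) ⟩
    fromℕ M * (fromℕ N * (fromℕ N * fromℕ N))
      ≤⟨ *-mono-≤ (0≤fromℕ M) (*-nonNegative 0≤z² (*-nonNegative 0≤z² 0≤z²)) M≤zW
           (*-mono-≤ (0≤fromℕ N) (*-nonNegative 0≤z² 0≤z²) N≤z² (*-mono-≤ (0≤fromℕ N) 0≤z² N≤z² N≤z²)) ⟩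
    (z * W) * ((z * z) * ((z * z) * (z * z)))
      ≈⟨ solve 2 (λ z W → (z :* W) :* ((z :* z) :* ((z :* z) :* (z :* z))) := (z :* z :* z :* z :* z :* z :* z) :* W) refl z W ⟩
    z * z * z * z * z * z * z * W             ≈⟨ *-congʳ (z⁷ z) ⟩
    z ^ 7 * W                                 ≈⟨ *-congʳ (^-assocʳ y 2 7) ⟩
    y ^ 14 * W                                ∎
    where
    z : Carrier
    z = y ^ 2
    z⁷ : ∀ z → z * z * z * z * z * z * z ≈ z ^ 7
    z⁷ z = trans (solve 1 (λ z → z :* z :* z :* z :* z :* z :* z := z :* (z :* (z :* (z :* (z :* (z :* z)))))) refl z)
      (*-congˡ (*-congˡ (*-congˡ (*-congˡ (*-congˡ (*-congˡ (sym (*-identityʳ z))))))))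
    2≤z : 2# ≤ z
    2≤z = ≤-trans 2≤L L≤y²
    0≤z : 0# ≤ z
    0≤z = ≤-trans 0≤2 2≤z
    0≤z² : 0# ≤ z * z
    0≤z² = *-nonNegative 0≤z 0≤z
    M≤zW : fromℕ M ≤ z * W
    M≤zW = ≤-trans M≤2W (*-monoˡ-≤ 0≤W 2≤z)
    N≤z² : fromℕ N ≤ z * z
    N≤z² = ≤-trans N≤2L (*-mono-≤ 0≤2 0≤z 2≤z L≤y²)

  0≤1⊔ : ∀ {x} → 0# ≤ 1# ⊔ x
  0≤1⊔ = ≤-trans 0≤1 (x≤x⊔y 1# _)

  0≤exp₂ : ∀ {t} → 0# ≤ t → 0# ≤ exp₂ t
  0≤exp₂ 0≤t = ≤exp₂ (BelowExp₂-0 0≤t)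

-- Construction of the low-degree tree

module _ (ℝ : Reals) where
  open Exponential ℝ
  open Bounds ℝ
  open ≤-Reasoning

  LowDegreeTree : ∀ {n} → FiniteMetricSpace ℝ n → Carrier → Carrier → Carrier → Set₁
  LowDegreeTree {n} X ddim mst ε = ∃ λ (T : Graph n) → IsSpanningTree T
    × fromℕ (maxDegree T) ≤ exp₂ (fromℕ 14 * ddim) * (1# ⊔ log₂ (ε ⁻¹))
    × weight X T ≤ (1# + ε) * mst

  lowDegreeTree-subsingleton : ∀ {n} (X : FiniteMetricSpace ℝ n) {ddim mst ε} → (∀ (x y : Fin n) → x ≡ y) →
    0# ≤ ddim → 0# ≤ ε → IsMSTWeight X mst → LowDegreeTree X ddim mst ε
  lowDegreeTree-subsingleton X {ddim} {mst} {ε} x≡y 0≤t 0≤ε ((T , spanning , wT≈m) , _) = T , spanning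
    , ≤-trans (fromℕ-mono-≤ (maxDegree≤ T (degree-subsingleton T x≡y)))
        (*-nonNegative (0≤exp₂ (*-nonNegative (0≤fromℕ 14) 0≤t)) 0≤1⊔)
    , (begin
      weight X T         ≈⟨ wT≈m ⟩
      mst                ≈⟨ *-identityˡ mst ⟨
      1# * mst           ≤⟨ *-monoˡ-≤ 0≤m (x≤x+y 0≤ε) ⟩
      (1# + ε) * mst     ∎)
    where
    open MetricTrees X
    0≤m : 0# ≤ mst
    0≤m = ≤-trans (0≤sumList (uncurry d) (λ _ → d≥0) (edges T)) (≤-reflexive wT≈m)

  lowDegreeTree : ∀ {m} (X : FiniteMetricSpace ℝ (suc (suc m))) {ddim mst ε} → IsDoublingDimension X ddim →
    IsMSTWeight X mst → 0# < ε → ε < 1# → LowDegreeTree X ddim mst ε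
  lowDegreeTree X {ddim} {mst} {ε} ((0≤t , covers) , _) isMST 0<ε ε<1 = RootedTree.graph T , RootedTree.isSpanningTree T
    , ≤-trans (fromℕ-mono-≤ {n = 2 ℕ.+ suc k ℕ.* (N ℕ.* N)} (maxDegree≤ (RootedTree.graph T) (relinked-degree (suc k) 0<D)))
        (≤-trans (degreeBound {M = suc k} {N = N} 2≤L (proj₁ (proj₂ approx)) 0≤1⊔ (s≤s z≤n) 2≤N (proj₂ (proj₂ scale)) N≤2L)
          (*-monoˡ-≤ 0≤1⊔ (proj₂ (proj₂ approx) 14)))
    , (begin
      weight X (RootedTree.graph T)         ≤⟨ weight-graph-≤ T ⟩
      totalToParent T                       ≤⟨ relinked-weight (suc k) 0<D ⟩
      (1# + ½ ^ suc k) * totalToParent P    ≤⟨ *-monoʳ-≤ (+-nonNegative 0≤1 (0≤^ (suc k) 0≤½)) (proj₁ (proj₂ minimal)) ⟩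
      (1# + ½ ^ suc k) * mst                ≤⟨ *-monoˡ-≤ 0≤mst (+-monoʳ-≤ 1# (proj₁ (proj₂ scale))) ⟩
      (1# + ε) * mst                        ∎)
    where
    open MetricTrees X
    2≤L : 2# ≤ exp₂ ddim
    2≤L = 2≤exp₂ X covers
    approx : ∃ λ y → exp₂ ddim ≤ y ^ 2 × (∀ C → y ^ C ≤ exp₂ (fromℕ C * ddim))
    approx = exp₂-root 0≤t 2≤L
    floor : ∃ λ m → 2# ^ m ≤ exp₂ ddim × exp₂ ddim < 2# ^ suc m
    floor = dyadicFloor (exp₂ ddim) (≤-trans 1≤2 2≤L)
    N : ℕ
    -- The packing argument needs an integer. The first power of 2 above `exp₂ ddim` is one, at the
    -- cost of a factor of at most 2.
    N = 2 ℕ.^ suc (proj₁ floor)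
    2≤N : 2 ℕ.≤ N
    2≤N = ℕ.*-monoʳ-≤ 2 (ℕ.m^n>0 2 (proj₁ floor))
    N≤2L : fromℕ N ≤ 2# * exp₂ ddim
    N≤2L = ≤-trans (≤-reflexive (fromℕ-2^ (suc (proj₁ floor)))) (*-monoʳ-≤ 0≤2 (proj₁ (proj₂ floor)))
    L≤N : exp₂ ddim ≤ fromℕ N
    L≤N = ≤-trans (<⇒≤ (proj₂ (proj₂ floor))) (≤-reflexive (sym (fromℕ-2^ (suc (proj₁ floor)))))
    coversN : CoversWithin N
    coversN x r =
      let cs , |cs|≤L , cover = covers x r
      in cs , fromℕ-cancel-≤ (≤-trans |cs|≤L L≤N) , cover
    scale : ∃ λ k → ½ ^ suc k ≤ ε × fromℕ (suc k) ≤ 2# * (1# ⊔ log₂ (ε ⁻¹))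
    scale = dyadicScale 0<ε ε<1
    k : ℕ
    k = proj₁ scale
    minimal : ∃ λ P → totalToParent P ≤ mst × IsMinimal P
    minimal = minimalTree Fin.zero isMST
    P : RootedTree _
    P = proj₁ minimal
    open Relinking X coversN P (proj₂ (proj₂ minimal))
    0<D : 0 ℕ.< suc k ℕ.* (N ℕ.* N)
    0<D = ℕ.*-mono-≤ {1} {suc k} (s≤s z≤n) (ℕ.*-mono-≤ (ℕ.<⇒≤ 2≤N) (ℕ.<⇒≤ 2≤N))
    T : RootedTree _
    T = relinkedTree (suc k) 0<D
    0≤mst : 0# ≤ mst
    0≤mst = ≤-trans (0≤sumList (uncurry d) (λ _ → d≥0) (edges (proj₁ (proj₁ isMST))))
      (≤-reflexive (proj₂ (proj₂ (proj₁ isMST))))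

proposition1p3 : ∃ λ (C : ℕ) → (ℝ : Reals) → let open Reals ℝ in
    (n : ℕ) (X : FiniteMetricSpace ℝ n) (ddim mst ε : Carrier) →
    IsDoublingDimension X ddim →
    IsMSTWeight X mst →
    0# < ε → ε < 1# →
    ∃ λ (T : Graph n) → IsSpanningTree T
    × fromℕ (maxDegree T) ≤ exp₂ (fromℕ C * ddim) * (1# ⊔ log₂ (ε ⁻¹))
    × weight X T ≤ (1# + ε) * mst
proposition1p3 = 14 , λ where
  ℝ 0 X ddim mst ε ((0≤t , _) , _) isMST 0<ε ε<1 →
    lowDegreeTree-subsingleton ℝ X (λ ()) 0≤t (proj₁ 0<ε) isMST
  ℝ 1 X ddim mst ε ((0≤t , _) , _) isMST 0<ε ε<1 →
    lowDegreeTree-subsingleton ℝ X (λ { Fin.zero Fin.zero → ≡.refl }) 0≤t (proj₁ 0<ε) isMST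
  ℝ (suc (suc m)) X ddim mst ε isDdim isMST 0<ε ε<1 → lowDegreeTree ℝ X isDdim isMST 0<ε ε<1
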